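{- There exists a deterministic algorithm (in the Word-RAM model) that, given the adjacency matrix of a tournament on $n$ vertices and a positive integer $k$, outputs a set of $k$ distinct kings of the tournament, or $\bot$ if the tournament does not contain $k$ kings, and runs in time $O(\min\{n^{\omega},\,k n^2\})$.
   Context: A tournament is a directed graph such that for every two distinct vertices $u,v$ exactly one of the edges $u\to v$, $v\to u$ is present. A vertex $v$ of a tournament is a king if for every other vertex $u$ there is a directed path from $v$ to $u$ of length (number of edges) at most $2$. Here $n^{\omega}$ denotes the (deterministic) time for multiplying two $n\times n$ matrices. Time is measured in the standard Word-RAM model. -}

module Defs where

open import Data.Bool.Base using (Bool; true; false; not; if_then_else_)
open import Data.Fin.Base using (Fin; toℕ)
open import Data.List.Base as List using (List; []; _∷_; _++_; length; lookup)
open import Data.List.Relation.Unary.All using (All)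
open import Data.Nat.Base
  using (ℕ; zero; suc; _+_; _*_; _∸_; _^_; _≤_; _<_; _<ᵇ_; _⊓_; _⊔_; ∣_-_∣; _/_; _%_)
open import Data.Nat.Properties using (_≟_; m^n≢0)
open import Data.Product.Base using (∃; _×_)
open import Data.Sum.Base using (_⊎_)
open import Data.Vec.Functional as Vector using (Vector)
open import Function.Definitions using (Injective)
open import Relation.Binary.PropositionalEquality.Core using (_≡_; _≢_)
open import Relation.Nullary.Decidable.Core using (does)
open import Relation.Nullary.Negation.Core using (¬_)

record Tournament (n : ℕ) : Set where
  field
    edge     : Fin n → Fin n → Bool
    loopless : ∀ u → edge u u ≡ false
    oneEdge  : ∀ u v → u ≢ v → edge u v ≡ not (edge v u)

-- Between distinct vertices of a loopless graph, a walk with at most two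
-- edges repeats no vertex, so at these lengths walks are paths.
data Walk {n : ℕ} (T : Tournament n) : Fin n → Fin n → ℕ → Set where
  stop : ∀ {u} → Walk T u u 0
  _∷_  : ∀ {u v w ℓ} → Tournament.edge T u v ≡ true → Walk T v w ℓ →
         Walk T u w (suc ℓ)

IsKing : ∀ {n} → Tournament n → Fin n → Set
IsKing T v = ∀ u → u ≢ v → ∃ λ ℓ → ℓ ≤ 2 × Walk T v u ℓ

DistinctKings : ∀ {n} → Tournament n → (k : ℕ) → Vector (Fin n) k → Set
DistinctKings T k vs = Injective _≡_ _≡_ vs × (∀ i → IsKing T (vs i))

-- Words of w bits are the natural numbers below 2 ^ w.  Constants and results
-- of operations are always words, so registers and memory hold words
-- throughout a computation whose input consists of words.
wrap : ℕ → ℕ → ℕ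
wrap w x = _%_ x (2 ^ w) {{m^n≢0 2 w}}

-- Applies f to the corresponding pairs of the w lowest bits.
bitwise : (ℕ → ℕ → ℕ) → ℕ → ℕ → ℕ → ℕ
bitwise f zero    x y = 0
bitwise f (suc w) x y = f (x % 2) (y % 2) + 2 * bitwise f w (x / 2) (y / 2)

data Op : Set where
  add sub mul div mod and or xor shl shr : Op

⟦_⟧ : Op → ℕ → ℕ → ℕ → ℕ
⟦ add ⟧ w x y       = wrap w (x + y)
⟦ sub ⟧ w x y       = wrap w (x + (2 ^ w ∸ y))
⟦ mul ⟧ w x y       = wrap w (x * y)
⟦ div ⟧ w x zero    = 0
⟦ div ⟧ w x (suc y) = wrap w (x / suc y)
⟦ mod ⟧ w x zero    = 0
⟦ mod ⟧ w x (suc y) = wrap w (x % suc y)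
⟦ and ⟧ w x y       = bitwise _⊓_ w x y
⟦ or  ⟧ w x y       = bitwise _⊔_ w x y
⟦ xor ⟧ w x y       = bitwise ∣_-_∣ w x y
⟦ shl ⟧ w x y       = wrap w (x * 2 ^ y)
⟦ shr ⟧ w x y       = wrap w (_/_ x (2 ^ y) {{m^n≢0 2 y}})

-- A program is a finite list, so it only mentions finitely many registers.
Reg Label : Set
Reg   = ℕ
Label = ℕ

data Instr : Set where
  const : Reg → ℕ → Instr
  arith : Op → Reg → Reg → Reg → Instr
  load  : Reg → Reg → Instr
  store : Reg → Reg → Instr
  jump  : Label → Instr
  jlt   : Reg → Reg → Label → Instr
  halt  : Instr

Program : Set
Program = List Instr

record State : Set where
  constructor state
  field
    pc  : ℕ
    reg : ℕ → ℕ
    mem : ℕ → ℕ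

_[_↦_] : (ℕ → ℕ) → ℕ → ℕ → (ℕ → ℕ)
(f [ a ↦ v ]) b = if does (b ≟ a) then v else f b

fetch : Program → ℕ → Instr
fetch []      _       = halt
fetch (i ∷ p) zero    = i
fetch (i ∷ p) (suc l) = fetch p l

exec : ℕ → Instr → State → State
exec w (const r c)     (state l R M) = state (suc l) (R [ r ↦ wrap w c ]) M
exec w (arith o r s t) (state l R M) = state (suc l) (R [ r ↦ ⟦ o ⟧ w (R s) (R t) ]) M
exec w (load r s)      (state l R M) = state (suc l) (R [ r ↦ M (R s) ]) M
exec w (store r s)     (state l R M) = state (suc l) R (M [ R r ↦ R s ])
exec w (jump l′)       (state l R M) = state l′ R M
exec w (jlt r s l′)    (state l R M) = state (if R r <ᵇ R s then l′ else suc l) R M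
exec w halt            σ             = σ

run : ℕ → Program → ℕ → State → State
run w p zero    σ = σ
run w p (suc t) σ = run w p t (exec w (fetch p (State.pc σ)) σ)

Halted : Program → State → Set
Halted p σ = fetch p (State.pc σ) ≡ halt

contents : List ℕ → ℕ → ℕ
contents []       _       = 0
contents (x ∷ xs) zero    = x
contents (x ∷ xs) (suc a) = contents xs a

-- The input occupies the memory cells from address 0 on; all other cells and
-- all registers are initially 0.
initial : List ℕ → State
initial xs = state 0 (λ _ → 0) (contents xs)

-- With word size w, on input xs, the program p halts after at most t steps,
-- leaving ys in the memory cells directly after those of the input.  (Halted
-- states do not change any more, so inspecting the state at time t is enough.)
ComputesWithin : (w : ℕ) → Program → (xs ys : List ℕ) → (t : ℕ) → Set
ComputesWithin w p xs ys t =
  Halted p σ × (∀ i → State.mem σ (length xs + toℕ i) ≡ lookup ys i)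
  where σ = run w p t (initial xs)

record Problem : Set₁ where
  field
    Instance : Set
    input    : Instance → List ℕ
    Output   : Instance → List ℕ → Set  -- the correct outputs
    Fits     : ℕ → Instance → Set       -- the numbers involved are words of w bits

-- Time O(f) on a Word-RAM whose word size is Ω(log N), N being the length of
-- the input: one program, independent of the instance and of the word size,
-- is correct for all w ≥ c log₂ N.
SolvableInTimeO : (P : Problem) → (Problem.Instance P → ℕ) → Set
SolvableInTimeO P f =
  ∃ λ (p : Program) → ∃ λ (c : ℕ) → ∃ λ (C : ℕ) →
  ∀ (w : ℕ) (x : Instance) → length (input x) ^ c ≤ 2 ^ w → Fits w x →
  ∃ λ (ys : List ℕ) → Output x ys × ComputesWithin w p (input x) ys (C * f x)
  where open Problem P

Matrix : ℕ → Set
Matrix n = Vector (Vector ℕ n) n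

rowMajor : ∀ {n} → Matrix n → List ℕ
rowMajor A = Vector.toList (Vector.concat A)

_⊗_ : ∀ {n} → Matrix n → Matrix n → Matrix n
(A ⊗ B) i l = Vector.foldr _+_ 0 (λ j → A i j * B j l)

record MatrixPair : Set where
  field
    n    : ℕ
    1≤n  : 1 ≤ n
    A B  : Matrix n

-- Multiplication of two n × n matrices of natural numbers; an algorithm only
-- has to succeed if the entries of the factors and of the product are words.
matrixMultiplication : Problem
matrixMultiplication = record
  { Instance = MatrixPair
  ; input    = inputOf
  ; Output   = λ x ys → ys ≡ productOf x
  ; Fits     = λ w x → All (_< 2 ^ w) (inputOf x) × All (_< 2 ^ w) (productOf x)
  }
  where
  inputOf productOf : MatrixPair → List ℕ
  inputOf   x = n ∷ rowMajor A ++ rowMajor B where open MatrixPair x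
  productOf x = rowMajor (A ⊗ B)             where open MatrixPair x

record KingsInstance : Set where
  field
    n    : ℕ
    1≤n  : 1 ≤ n
    T    : Tournament n
    k    : ℕ
    1≤k  : 1 ≤ k

adjacency : ∀ {n} → Tournament n → Matrix n
adjacency T u v = if Tournament.edge T u v then 1 else 0

-- The output ⊥ is encoded as the single word 0, and a set of k vertices as
-- the word 1 followed by its elements.
kKings : Problem
kKings = record
  { Instance = KingsInstance
  ; input    = inputOf
  ; Output   = Correct
  ; Fits     = λ w x → All (_< 2 ^ w) (inputOf x)
  }
  where
  inputOf : KingsInstance → List ℕ
  inputOf x = n ∷ k ∷ rowMajor (adjacency T) where open KingsInstance x

  Correct : KingsInstance → List ℕ → Set
  Correct x ys =
      (∃ λ vs → DistinctKings T k vs ×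
         ys ≡ 1 ∷ Vector.toList (Vector.map toℕ vs))
    ⊎ (¬ (∃ λ vs → DistinctKings T k vs) × ys ≡ 0 ∷ [])
    where open KingsInstance x

{-# OPTIONS --safe #-}

-- Let A be the adjacency matrix.  Since v is a king iff A v u or (A ⊗ A) v u is
-- positive for every u ≢ v, the kings can be read off A and A ⊗ A in O(n²) steps.
--
-- Independently of the matrix product, say that s covers v if s → v and every
-- out-neighbour of v is one of s.  The kings are the uncovered vertices, and
-- covering is transitive and strictly increases the outdegree.  Hence, going
-- through the vertices by decreasing outdegree, a vertex is a king iff no king
-- found before covers it.  Stopping at k kings, this takes O(k n²) steps.
--
-- As M need not be computable, the multiplication program is run with a budget of
-- k n² steps; if it does not halt, then k n² = O(M n) and the second method is
-- used.  The program may use all addresses, so it is simulated with words of one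
-- bit less, in the upper half of the memory; the input survives in the lower
-- half.  Finally n² = O(M n), because a product without zeros has n² cells to be
-- written.

module Submission where

open import Defs
open import Data.Bool.Base as Bool using (true; false; if_then_else_)
open import Data.Fin.Base using (Fin; zero; suc; toℕ; fromℕ<; combine; quotRem)
open import Data.Fin.Properties
  using (toℕ<n; toℕ-fromℕ<; toℕ-injective; toℕ-combine; remQuot-combine; pigeonhole)
open import Data.List.Base using (List; []; _∷_; _++_; length; lookup; tabulate)
open import Data.List.Membership.Propositional.Properties using (∈-lookup)
open import Data.List.Properties using (length-tabulate; length-++)
open import Data.List.Relation.Unary.All as All using (All; []; _∷_)
open import Data.List.Relation.Unary.All.Properties using (tabulate⁺; ++⁺)
open import Data.Nat.Base
open import Data.Nat.Divisibility using (divides-refl)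
open import Data.Nat.DivMod
  using (m%n<n; m<n⇒m%n≡m; m∣n⇒o%n%m≡o%m; [m+n]%n≡m%n; m<n*o⇒m/o<n; m*n/n≡m; +-distrib-/-∣ʳ)
open import Data.Nat.Properties
open import Data.Nat.Solver using (module +-*-Solver)
open import Data.Product.Base using (∃; _×_; _,_; proj₁; proj₂; swap)
open import Data.Sum.Base using (_⊎_; inj₁; inj₂)
open import Data.Unit.Base using (tt)
open import Data.Vec.Functional as Vector using (Vector)
open import Relation.Binary.PropositionalEquality
open import Relation.Nullary.Decidable.Core using (Dec; yes; no)
open import Relation.Nullary.Decidable using (_×-dec_)
open import Relation.Nullary.Negation.Core using (¬_; contradiction)

-- Structured commands for the Word-RAM

-- Some obstacles shape the construction. The word size is not part of the input, so the boundary
-- between the two halves of the memory is found at run time, from the wrap-around of `0 - 1`. The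
-- step budget has to fit into one register; this holds only for `k ≤ n`, so larger `k` is rejected
-- before the simulation starts, which is correct because there are only `n` vertices. Loops count
-- upwards from `0`, so vertices are ordered by the number of non-successors. They are not sorted:
-- every level rescans all vertices, which costs O(n²) altogether, and the expensive test is run on
-- a vertex only at its own level. Kings are written straight into their final output cells. If
-- fewer than `k` turn up, those cells may stay filled, because the output ⊥ concerns only the cell
-- in front of them, and that cell is blank from the beginning.

Regs Mem : Set
Regs = ℕ → ℕ
Mem  = ℕ → ℕ

update-same : ∀ (f : ℕ → ℕ) a {v b} → b ≡ a → (f [ a ↦ v ]) b ≡ v
update-same f a {b = b} eq with b ≡ᵇ a | ≡⇒≡ᵇ b a eq
... | true | _ = refl

update-other : ∀ (f : ℕ → ℕ) a {v b} → b ≢ a → (f [ a ↦ v ]) b ≡ f b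
update-other f a {b = b} ne with b ≡ᵇ a in eq
... | true  = contradiction (≡ᵇ⇒≡ b a (subst Bool.T (sym eq) tt)) ne
... | false = refl

<⇒<ᵇ≡true : ∀ {m n} → m < n → (m <ᵇ n) ≡ true
<⇒<ᵇ≡true {m} {n} m<n with m <ᵇ n | <⇒<ᵇ m<n
... | true | _ = refl

≥⇒<ᵇ≡false : ∀ {m n} → n ≤ m → (m <ᵇ n) ≡ false
≥⇒<ᵇ≡false {m} {n} n≤m with m <ᵇ n in eq
... | false = refl
... | true  = contradiction (<ᵇ⇒< m n (subst Bool.T (sym eq) tt)) (≤⇒≯ n≤m)

wrap-< : ∀ w {x} → x < 2 ^ w → wrap w x ≡ x
wrap-< w x<W = m<n⇒m%n≡m {{m^n≢0 2 w}} x<W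

wrap<2^w : ∀ w x → wrap w x < 2 ^ w
wrap<2^w w x = m%n<n x (2 ^ w) {{m^n≢0 2 w}}

run-+ : ∀ w p s t σ → run w p (s + t) σ ≡ run w p t (run w p s σ)
run-+ w p zero    t σ = refl
run-+ w p (suc s) t σ = run-+ w p s t _

-- Only const, arith, load and store are meant to occur as prim.
data Cmd : Set where
  skip : Cmd
  prim : Instr → Cmd
  _⨾_  : Cmd → Cmd → Cmd
  ifLt : Reg → Reg → Cmd → Cmd → Cmd
  for  : Reg → Reg → Cmd → Cmd

infixr 6 _⨾_

next : Label → Cmd → Label
next l skip           = l
next l (prim i)       = suc l
next l (c ⨾ d)        = next (next l c) d
next l (ifLt r s c d) = next (suc (next (suc l) d)) c
next l (for r s c)    = suc (suc (next (3 + l) c))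

-- A loop expects register 1 to hold the increment 1.
compile : Label → Cmd → Program → Program
compile l skip           is = is
compile l (prim i)       is = i ∷ is
compile l (c ⨾ d)        is = compile l c (compile (next l c) d is)
compile l (ifLt r s c d) is =
  jlt r s (suc m) ∷ compile (suc l) d (jump (next (suc m) c) ∷ compile (suc m) c is)
  where m = next (suc l) d
compile l (for r s c)    is =
  const r 0 ∷ jlt r s (3 + l) ∷ jump (2 + m) ∷
  compile (3 + l) c (arith add r r 1 ∷ jump (1 + l) ∷ is)
  where m = next (3 + l) c

-- Placement is expressed by `fetch` alone and leaves the rest of `p` open, so a command is verified
-- once for all positions.
data At (p : Program) : Cmd → Label → Label → Set where
  skip : ∀ {l} → At p skip l l
  prim : ∀ {i l} → fetch p l ≡ i → At p (prim i) l (suc l)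
  _⨾_  : ∀ {c d l m n} → At p c l m → At p d m n → At p (c ⨾ d) l n
  ifLt : ∀ {r s c d l m n} → fetch p l ≡ jlt r s (suc m) → At p d (suc l) m →
         fetch p m ≡ jump n → At p c (suc m) n → At p (ifLt r s c d) l n
  for  : ∀ {r s c l m} → fetch p l ≡ const r 0 → fetch p (1 + l) ≡ jlt r s (3 + l) →
         fetch p (2 + l) ≡ jump (2 + m) → At p c (3 + l) m →
         fetch p m ≡ arith add r r 1 → fetch p (1 + m) ≡ jump (1 + l) →
         At p (for r s c) l (2 + m)

-- Past the end of a list `fetch` returns `halt`, so the equation can be demanded at every offset
-- without bounds.
record Suffix (p : Program) (l : Label) (is : Program) : Set where
  constructor suffix
  field
    fetch-suffix : ∀ i → fetch p (l + i) ≡ fetch is i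

open Suffix

suffix-head : ∀ {p l i is} → Suffix p l (i ∷ is) → fetch p l ≡ i
suffix-head {p} {l} h = trans (cong (fetch p) (sym (+-identityʳ l))) (fetch-suffix h 0)

suffix-tail : ∀ {p l i is} → Suffix p l (i ∷ is) → Suffix p (suc l) is
suffix-tail {p} {l} h = suffix λ j →
  trans (cong (fetch p) (sym (+-suc l j))) (fetch-suffix h (suc j))

locate : ∀ {p l is} c → Suffix p l (compile l c is) → At p c l (next l c) × Suffix p (next l c) is
locate skip     h = skip , h
locate (prim i) h = prim (suffix-head h) , suffix-tail h
locate (c ⨾ d)  h with locate c h
... | atc , h₁ with locate d h₁
... | atd , h₂ = atc ⨾ atd , h₂
locate (ifLt r s c d) h with locate d (suffix-tail h)
... | atd , h₁ with locate c (suffix-tail h₁)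
... | atc , h₂ = ifLt (suffix-head h) atd (suffix-head h₁) atc , h₂
locate (for r s c) h with suffix-tail h
... | h₁ with suffix-tail h₁
... | h₂ with locate c (suffix-tail h₂)
... | atc , h₃ =
  for (suffix-head h) (suffix-head h₁) (suffix-head h₂) atc (suffix-head h₃)
      (suffix-head (suffix-tail h₃)) ,
  suffix-tail (suffix-tail h₃)

record Reach (w : ℕ) (p : Program) (σ : State) (t : ℕ) (Q : State → Set) : Set where
  constructor reach
  field
    {steps} : ℕ
    steps≤  : steps ≤ t
    reached : Q (run w p steps σ)

reach-step : ∀ {w p σ i t Q} → fetch p (State.pc σ) ≡ i →
             Reach w p (exec w i σ) t Q → Reach w p σ (suc t) Q
reach-step refl (reach s≤t q) = reach (s≤s s≤t) q

reach-bind : ∀ {w p σ t u} {Q Q′ : State → Set} → Reach w p σ t Q →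
             (∀ σ′ → Q σ′ → Reach w p σ′ u Q′) → Reach w p σ (t + u) Q′
reach-bind {w} {p} {σ} {Q′ = Q′} (reach {s} s≤t q) k with k _ q
... | reach {s′} s′≤u q′ =
  reach (+-mono-≤ s≤t s′≤u) (subst Q′ (sym (run-+ w p s s′ σ)) q′)

reach-mono : ∀ {w p σ t u} {Q Q′ : State → Set} → t ≤ u → (∀ {σ′} → Q σ′ → Q′ σ′) →
             Reach w p σ t Q → Reach w p σ u Q′
reach-mono t≤u f (reach s≤t q) = reach (≤-trans s≤t t≤u) (f q)

reach-done : ∀ {w p σ t} {Q : State → Set} → Q σ → Reach w p σ t Q
reach-done q = reach {steps = 0} z≤n q

EndsAt : Label → (Regs → Mem → Set) → State → Set
EndsAt l Q (state l′ R M) = l′ ≡ l × Q R M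

-- From registers R and memory M, the command c ends after at most t steps
-- with registers and memory satisfying Q.
record Exec (w : ℕ) (c : Cmd) (R : Regs) (M : Mem) (t : ℕ) (Q : Regs → Mem → Set) : Set where
  constructor exec-by
  field
    exec-at : ∀ {p l l′} → At p c l l′ → Reach w p (state l R M) t (EndsAt l′ Q)

open Exec

exec-mono : ∀ {w c R M t u} {Q Q′ : Regs → Mem → Set} → t ≤ u → (∀ {R′ M′} → Q R′ M′ → Q′ R′ M′) →
            Exec w c R M t Q → Exec w c R M u Q′
exec-mono {Q = Q} {Q′} t≤u f e = exec-by λ at →
  reach-mono t≤u (λ (eq , q) → eq , f q) (exec-at e at)

done : ∀ {w R M t} {Q : Regs → Mem → Set} → Q R M → Exec w skip R M t Q
done q = exec-by λ { skip → reach-done (refl , q) }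

seq : ∀ {w c d R M t u} {Q : Regs → Mem → Set} →
      Exec w c R M t (λ R′ M′ → Exec w d R′ M′ u Q) → Exec w (c ⨾ d) R M (t + u) Q
seq {w} {d = d} {u = u} {Q} e = exec-by λ { (_⨾_ {m = m} atc atd) →
  reach-bind (exec-at e atc) λ { (state _ _ _) (refl , k) → exec-at k atd } }

prim-step : ∀ {w i d R M R′ M′ t} {Q : Regs → Mem → Set} →
            (∀ l → exec w i (state l R M) ≡ state (suc l) R′ M′) →
            Exec w d R′ M′ t Q → Exec w (prim i ⨾ d) R M (suc t) Q
prim-step h e = exec-by λ { (_⨾_ {l = l} (prim eq) atd) →
  reach-step eq (subst (λ σ → Reach _ _ σ _ _) (sym (h l)) (exec-at e atd)) }

-- The rules named with `!` take the proof for the remaining command as last argument, so that a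
-- proof term follows the program text. Register numbers are mostly literals, hence lookups in
-- updated registers compute and many side conditions are `refl`.
const! : ∀ {w r x d R M t} {Q : Regs → Mem → Set} → x < 2 ^ w →
         Exec w d (R [ r ↦ x ]) M t Q → Exec w (prim (const r x) ⨾ d) R M (suc t) Q
const! {w} {r} {R = R} x<W = prim-step λ l →
  cong (λ x → state (suc l) (R [ r ↦ x ]) _) (wrap-< w x<W)

arith! : ∀ {w o r s t x y v d R M u} {Q : Regs → Mem → Set} →
         R s ≡ x → R t ≡ y → ⟦ o ⟧ w x y ≡ v →
         Exec w d (R [ r ↦ v ]) M u Q → Exec w (prim (arith o r s t) ⨾ d) R M (suc u) Q
arith! {w} {r = r} {R = R} refl refl eq = prim-step λ l →
  cong (λ x → state (suc l) (R [ r ↦ x ]) _) eq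

add! : ∀ {w r s t x y d R M u} {Q : Regs → Mem → Set} → R s ≡ x → R t ≡ y → x + y < 2 ^ w →
       Exec w d (R [ r ↦ x + y ]) M u Q → Exec w (prim (arith add r s t) ⨾ d) R M (suc u) Q
add! {w} rs rt x+y<W = arith! rs rt (wrap-< w x+y<W)

mul! : ∀ {w r s t x y d R M u} {Q : Regs → Mem → Set} → R s ≡ x → R t ≡ y → x * y < 2 ^ w →
       Exec w d (R [ r ↦ x * y ]) M u Q → Exec w (prim (arith mul r s t) ⨾ d) R M (suc u) Q
mul! {w} rs rt xy<W = arith! rs rt (wrap-< w xy<W)

load! : ∀ {w r s a v d R M t} {Q : Regs → Mem → Set} → R s ≡ a → M a ≡ v →
        Exec w d (R [ r ↦ v ]) M t Q → Exec w (prim (load r s) ⨾ d) R M (suc t) Q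
load! refl refl = prim-step λ l → refl

store! : ∀ {w r s a v d R M t} {Q : Regs → Mem → Set} → R r ≡ a → R s ≡ v →
         Exec w d R (M [ a ↦ v ]) t Q → Exec w (prim (store r s) ⨾ d) R M (suc t) Q
store! refl refl = prim-step λ l → refl

-- The code of `d` comes first and must jump over that of `c`; the comparison and this jump make the
-- `2`.
ifLt! : ∀ {w r s x y c d R M t} {Q : Regs → Mem → Set} → R r ≡ x → R s ≡ y →
        (x < y → Exec w c R M t Q) → (y ≤ x → Exec w d R M t Q) →
        Exec w (ifLt r s c d) R M (2 + t) Q
ifLt! {w} {r} {s} {c = c} {d} {R} {M} {t} {Q} refl refl yes! no! = exec-by go
  where
  go : ∀ {p l l′} → At p (ifLt r s c d) l l′ → Reach w p (state l R M) (2 + t) (EndsAt l′ Q)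
  go {p} {l} {n} (ifLt {m = m} e₁ atd e₂ atc) with <-≤-connex (R r) (R s)
  ... | inj₁ lt = reach-step e₁ (subst (λ b → Reach w p (state (if b then suc m else suc l) R M) (1 + t) (EndsAt n Q))
                    (sym (<⇒<ᵇ≡true lt)) (reach-mono (n≤1+n t) (λ q → q) (exec-at (yes! lt) atc)))
  ... | inj₂ ge = reach-step e₁ (subst (λ b → Reach w p (state (if b then suc m else suc l) R M) (1 + t) (EndsAt n Q))
                    (sym (≥⇒<ᵇ≡false ge))
                    (subst (λ u → Reach w p (state (suc l) R M) u (EndsAt n Q)) (+-comm t 1)
                      (reach-bind (exec-at (no! ge) atd) λ { (state _ _ _) (refl , q) →
                        reach-step e₂ (reach-done (refl , q)) })))

-- Counting loops and their running time

∑ : ℕ → (ℕ → ℕ) → ℕ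
∑ zero    f = 0
∑ (suc n) f = ∑ n f + f n

-- The invariant `I j` holds just before the comparison of round `j`. Each round pays 3 for
-- comparison, increment and jump back; the final 3 are the initialisation, the failing comparison
-- and the exit jump.
for-sum! : ∀ {w r s c R M} (N : ℕ) (t : ℕ → ℕ) (I : ℕ → Regs → Mem → Set) {Q : Regs → Mem → Set} →
       N < 2 ^ w →
       (∀ {j R′ M′} → I j R′ M′ → R′ 1 ≡ 1 × R′ s ≡ N × R′ r ≡ j) →
       I 0 (R [ r ↦ 0 ]) M →
       (∀ j {R′ M′} → j < N → I j R′ M′ →
         Exec w c R′ M′ (t j) (λ R″ M″ → (R″ 1 ≡ 1 × R″ r ≡ j) × I (suc j) (R″ [ r ↦ suc j ]) M″)) →
       (∀ {R′ M′} → I N R′ M′ → Q R′ M′) →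
       Exec w (for r s c) R M (∑ N (λ j → t j + 3) + 3) Q
for-sum! {w} {r} {s} {c} {R} {M} N t I {Q} N<W facts I₀ body fin = exec-by go
  where
  go : ∀ {p l l′} → At p (for r s c) l l′ →
       Reach w p (state l R M) (∑ N (λ j → t j + 3) + 3) (EndsAt l′ Q)
  go {p} {l} (for {m = m} e₀ e₁ e₂ atc e₃ e₄) =
    subst (λ u → Reach w p (state l R M) u (EndsAt (2 + m) Q)) eq (reach-step e₀
      (subst (λ z → Reach w p (state (suc l) (R [ r ↦ z ]) M) (Left N 0 + 2) (EndsAt (2 + m) Q))
             (sym (wrap-< w (<-≤-trans (s≤s z≤n) N<W)))
             (loop N 0 (+-identityʳ N) I₀)))
    where
    -- The cost of `k` rounds from round `j` on, unfolded from the front as the loop runs; `∑`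
    -- unfolds from the back, and `left-snoc` reconciles them.
    Left : ℕ → ℕ → ℕ
    Left zero    j = 0
    Left (suc k) j = t j + 3 + Left k (suc j)
    loop : ∀ k j {R′ M′} → k + j ≡ N → I j R′ M′ →
           Reach w p (state (1 + l) R′ M′) (Left k j + 2) (EndsAt (2 + m) Q)
    loop zero j {R′} {M′} refl i with facts i
    ... | f₁ , f₂ , f₃ = reach-step e₁
      (subst (λ b → Reach w p (state (if b then 3 + l else 2 + l) R′ M′) 1 (EndsAt (2 + m) Q))
        (sym (≥⇒<ᵇ≡false (≤-reflexive (trans f₂ (sym f₃)))))
        (reach-step e₂ (reach-done (refl , fin i))))
    loop (suc k) j {R′} {M′} k+j i with facts i
    ... | f₁ , f₂ , f₃ = subst (λ u → Reach w p (state (1 + l) R′ M′) u (EndsAt (2 + m) Q)) time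
      (reach-step e₁
        (subst (λ b → Reach w p (state (if b then 3 + l else 2 + l) R′ M′) (t j + (2 + (Left k (suc j) + 2))) (EndsAt (2 + m) Q))
          (sym (<⇒<ᵇ≡true (subst₂ _<_ (sym f₃) (sym f₂) j<N)))
          (reach-bind (exec-at (body j j<N i) atc) λ { (state _ R″ M″) (refl , (g₁ , g₂) , i′) →
            reach-step e₃ (reach-step e₄
              (subst (λ z → Reach w p (state (suc l) (R″ [ r ↦ z ]) M″) (Left k (suc j) + 2) (EndsAt (2 + m) Q))
                (sym (trans (cong₂ (λ x y → wrap w (x + y)) g₂ g₁)
                       (trans (wrap-< w (subst (_< 2 ^ w) (+-comm 1 j) (≤-<-trans j<N N<W))) (+-comm j 1))))
                (loop k (suc j) (trans (+-suc k j) k+j) i′))) })))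
      where
      j<N : j < N
      j<N = subst (j <_) k+j (s≤s (m≤n+m j k))
      time : suc (t j + (2 + (Left k (suc j) + 2))) ≡ t j + 3 + Left k (suc j) + 2
      time = trans (cong suc (sym (+-assoc (t j) 2 _)))
               (trans (sym (+-assoc (suc (t j + 2)) (Left k (suc j)) 2))
                 (cong (λ x → x + Left k (suc j) + 2) (sym (+-suc (t j) 2))))
    left-snoc : ∀ k j → Left (suc k) j ≡ Left k j + (t (k + j) + 3)
    left-snoc zero    j = +-comm (t j + 3) 0
    left-snoc (suc k) j = begin
      t j + 3 + Left (suc k) (suc j)                    ≡⟨ cong (t j + 3 +_) (left-snoc k (suc j)) ⟩
      t j + 3 + (Left k (suc j) + (t (k + suc j) + 3))  ≡⟨ +-assoc (t j + 3) _ _ ⟨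
      t j + 3 + Left k (suc j) + (t (k + suc j) + 3)    ≡⟨ cong (λ x → t j + 3 + Left k (suc j) + (t x + 3)) (+-suc k j) ⟩
      t j + 3 + Left k (suc j) + (t (suc k + j) + 3)    ∎
      where open ≡-Reasoning
    left≡∑ : ∀ k → Left k 0 ≡ ∑ k (λ j → t j + 3)
    left≡∑ zero    = refl
    left≡∑ (suc k) = trans (left-snoc k 0)
      (cong₂ _+_ (left≡∑ k) (cong (λ x → t x + 3) (+-identityʳ k)))
    eq : suc (Left N 0 + 2) ≡ ∑ N (λ j → t j + 3) + 3
    eq = trans (sym (+-suc (Left N 0) 2)) (cong (_+ 3) (left≡∑ N))

∑-mono : ∀ n {f g : ℕ → ℕ} → (∀ i → i < n → f i ≤ g i) → ∑ n f ≤ ∑ n g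
∑-mono zero    h = z≤n
∑-mono (suc n) h = +-mono-≤ (∑-mono n λ i i<n → h i (m≤n⇒m≤1+n i<n)) (h n ≤-refl)

∑-const : ∀ n c → ∑ n (λ _ → c) ≡ n * c
∑-const zero    c = refl
∑-const (suc n) c = trans (+-comm _ c) (cong (c +_) (∑-const n c))

for! : ∀ {w r s c R M} (N t : ℕ) (I : ℕ → Regs → Mem → Set) {Q : Regs → Mem → Set} →
       N < 2 ^ w →
       (∀ {j R′ M′} → I j R′ M′ → R′ 1 ≡ 1 × R′ s ≡ N × R′ r ≡ j) →
       I 0 (R [ r ↦ 0 ]) M →
       (∀ j {R′ M′} → j < N → I j R′ M′ →
         Exec w c R′ M′ t (λ R″ M″ → (R″ 1 ≡ 1 × R″ r ≡ j) × I (suc j) (R″ [ r ↦ suc j ]) M″)) →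
       (∀ {R′ M′} → I N R′ M′ → Q R′ M′) →
       Exec w (for r s c) R M (N * (t + 3) + 3) Q
for! N t I N<W facts I₀ body fin =
  subst (λ u → Exec _ _ _ _ (u + 3) _) (∑-const N (t + 3))
    (for-sum! N (λ _ → t) I N<W facts I₀ body fin)

-- Kings and covering

-- Arcs are numbers indexed by numbers, because this is how a program meets them in memory; only
-- indices below `n` are constrained.
record IsTournament (n : ℕ) (a : ℕ → ℕ → ℕ) : Set where
  field
    irrefl : ∀ {u} → u < n → a u u ≡ 0
    arc    : ∀ {u v} → u < n → v < n → u ≢ v → (a u v ≡ 1 × a v u ≡ 0) ⊎ (a u v ≡ 0 × a v u ≡ 1)

King : (n : ℕ) → (ℕ → ℕ → ℕ) → ℕ → Set
King n a v = ∀ u → u < n → u ≢ v → a v u ≡ 1 ⊎ ∃ λ x → x < n × a v x ≡ 1 × a x u ≡ 1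

-- This is the covering relation of social choice theory; its maximal elements form the uncovered
-- set.
Covers : (n : ℕ) → (ℕ → ℕ → ℕ) → ℕ → ℕ → Set
Covers n a s v = a s v ≡ 1 × (∀ {x} → x < n → a v x ≤ a s x)

-- For a row `f` of zeros and ones this is the co-outdegree, the vertex itself included. An upward
-- loop over it visits the vertices by decreasing outdegree.
nonSuccessors : (ℕ → ℕ) → ℕ → ℕ
nonSuccessors f zero    = 0
nonSuccessors f (suc m) = (1 ∸ f m) + nonSuccessors f m

nonSuccessors-≤ : ∀ f m → nonSuccessors f m ≤ m
nonSuccessors-≤ f zero    = z≤n
nonSuccessors-≤ f (suc m) = +-mono-≤ (m∸n≤m 1 (f m)) (nonSuccessors-≤ f m)

nonSuccessors-antitone : ∀ f g m → (∀ {x} → x < m → f x ≤ g x) → nonSuccessors g m ≤ nonSuccessors f m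
nonSuccessors-antitone f g zero    h = z≤n
nonSuccessors-antitone f g (suc m) h =
  +-mono-≤ (∸-monoʳ-≤ 1 (h ≤-refl)) (nonSuccessors-antitone f g m λ x<m → h (m≤n⇒m≤1+n x<m))

nonSuccessors-strict : ∀ f g m → (∀ {x} → x < m → f x ≤ g x) →
                       ∀ {v} → v < m → f v ≡ 0 → g v ≡ 1 → nonSuccessors g m < nonSuccessors f m
nonSuccessors-strict f g (suc m) h {v} v<1+m fv gv with v ≟ m
... | yes refl rewrite fv | gv = s≤s (nonSuccessors-antitone f g m λ x<m → h (m≤n⇒m≤1+n x<m))
... | no v≢m = +-mono-≤-< (∸-monoʳ-≤ 1 (h ≤-refl))
  (nonSuccessors-strict f g m (λ x<m → h (m≤n⇒m≤1+n x<m)) (≤∧≢⇒< (≤-pred v<1+m) v≢m) fv gv)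

module _ {n : ℕ} {a : ℕ → ℕ → ℕ} (T : IsTournament n a) where
  open IsTournament T

  entry≤1 : ∀ {u v} → u < n → v < n → a u v ≤ 1
  entry≤1 {u} {v} u<n v<n with u ≟ v
  ... | yes refl = subst (_≤ 1) (sym (irrefl u<n)) z≤n
  ... | no u≢v with arc u<n v<n u≢v
  ... | inj₁ (e , _) = ≤-reflexive e
  ... | inj₂ (e , _) = subst (_≤ 1) (sym e) z≤n

  arc⇒≢ : ∀ {u v} → u < n → a u v ≡ 1 → u ≢ v
  arc⇒≢ u<n uv refl = contradiction (trans (sym (irrefl u<n)) uv) λ ()

  arc⇒¬reverse : ∀ {u v} → u < n → v < n → a u v ≡ 1 → a v u ≡ 0
  arc⇒¬reverse u<n v<n uv with arc u<n v<n (arc⇒≢ u<n uv)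
  ... | inj₁ (_ , e) = e
  ... | inj₂ (e , _) = contradiction (trans (sym e) uv) λ ()

  -- The vertex `s` is out of reach for `v`: the arc between them points to `v`, and every
  -- out-neighbour `x` of `v` satisfies `s → x`, hence not `x → s`.
  covered⇒¬king : ∀ {s v} → s < n → v < n → Covers n a s v → ¬ King n a v
  covered⇒¬king {s} s<n v<n (sv , s⊇v) king with king s s<n (arc⇒≢ s<n sv)
  ... | inj₁ vs = contradiction (trans (sym vs) (arc⇒¬reverse s<n v<n sv)) λ ()
  ... | inj₂ (x , x<n , vx , xs) =
    contradiction (subst₂ _≤_ vx (arc⇒¬reverse x<n s<n xs) (s⊇v x<n)) λ ()

  covers? : ∀ s v → Dec (Covers n a s v)
  covers? s v = (a s v ≟ 1) ×-dec allUpTo? (λ x → a v x ≤? a s x) n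

  -- If `u → v` but `u` does not cover `v`, some `x` has `v → x` and not `u → x`. Then `x ≢ u`, so
  -- `x → u`, and `x` is the midpoint of a path from `v` to `u`.
  king∨covered : ∀ {v} → v < n → King n a v ⊎ ∃ λ u → u < n × Covers n a u v
  king∨covered {v} v<n with anyUpTo? (λ u → covers? u v) n
  ... | yes (u , u<n , c) = inj₂ (u , u<n , c)
  ... | no ¬covered = inj₁ king
    where
    king : King n a v
    king u u<n u≢v with arc u<n v<n u≢v
    ... | inj₂ (_ , vu) = inj₁ vu
    ... | inj₁ (uv , vu) with anyUpTo? (λ x → a u x <? a v x) n
    ... | no ¬∃ = contradiction (u , u<n , uv , λ {x} x<n → ≮⇒≥ λ lt → ¬∃ (x , x<n , lt)) ¬covered
    ... | yes (x , x<n , ux<vx) with arc x<n u<n x≢u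
      where
      x≢u : x ≢ u
      x≢u refl = n≮0 (subst (a u u <_) vu ux<vx)
    ... | inj₁ (xu , ux) = inj₂ (x , x<n , ≤-antisym (entry≤1 v<n x<n) (subst (_< a v x) ux ux<vx) , xu)
    ... | inj₂ (_ , ux) = contradiction (subst (_< a v x) ux ux<vx) (≤⇒≯ (entry≤1 v<n x<n))

  covers-trans : ∀ {s u v} → s < n → v < n → Covers n a s u → Covers n a u v → Covers n a s v
  covers-trans {s} {u} {v} s<n v<n (_ , s⊇u) (uv , u⊇v) =
    ≤-antisym (entry≤1 s<n v<n) (subst (_≤ a s v) uv (s⊇u v<n)) , λ x<n → ≤-trans (u⊇v x<n) (s⊇u x<n)

  covers⇒fewer : ∀ {s v} → s < n → v < n → Covers n a s v → nonSuccessors (a s) n < nonSuccessors (a v) n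
  covers⇒fewer {s} {v} s<n v<n (sv , s⊇v) =
    nonSuccessors-strict (a v) (a s) n s⊇v v<n (irrefl v<n) sv

  -- A vertex of least co-outdegree among those covering v is uncovered, as
  -- covering is transitive.
  covered⇒kingCovers : ∀ {s v} → s < n → v < n → Covers n a s v →
                       ∃ λ t → t < n × King n a t × Covers n a t v
  covered⇒kingCovers {s} {v} s<n v<n c = search _ s<n ≤-refl c
    where
    search : ∀ m {s} → s < n → nonSuccessors (a s) n ≤ m → Covers n a s v →
             ∃ λ t → t < n × King n a t × Covers n a t v
    search m s<n le c with king∨covered s<n
    ... | inj₁ king = _ , s<n , king , c
    search zero s<n le c | inj₂ (u , u<n , us) =
      contradiction (<-≤-trans (covers⇒fewer u<n s<n us) le) λ ()
    search (suc m) s<n le c | inj₂ (u , u<n , us) =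
      search m u<n (≤-pred (<-≤-trans (covers⇒fewer u<n s<n us) le)) (covers-trans u<n v<n us c)

-- Recording kings

-- S lists c kings among the vertices already examined, all of them if c < k.
record Found (n : ℕ) (a : ℕ → ℕ → ℕ) (k : ℕ) (S : ℕ → ℕ) (c : ℕ) (Done : ℕ → Set) : Set where
  constructor found
  field
    count≤   : c ≤ k
    sound    : ∀ {i} → i < c → S i < n × King n a (S i) × Done (S i)
    distinct : ∀ {i j} → i < c → j < c → S i ≡ S j → i ≡ j
    complete : c < k → ∀ {v} → v < n → King n a v → Done v → ∃ λ i → i < c × S i ≡ v

open Found

module _ {n : ℕ} {a : ℕ → ℕ → ℕ} {k : ℕ} where

  found-none : ∀ {S} {Done : ℕ → Set} → (∀ {v} → v < n → ¬ Done v) → Found n a k S 0 Done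
  found-none none = found z≤n (λ ()) (λ ()) λ _ v<n _ dv → contradiction dv (none v<n)

  found-cong : ∀ {S S′ c} {Done Done′ : ℕ → Set} → (∀ {i} → i < c → S′ i ≡ S i) →
               (∀ {v} → v < n → Done v → Done′ v) → (∀ {v} → v < n → Done′ v → Done v) →
               Found n a k S c Done → Found n a k S′ c Done′
  found-cong {S} {S′} {c} {Done} {Done′} S≗ to from F = found (count≤ F) sound′
    (λ i<c j<c eq → distinct F i<c j<c (trans (sym (S≗ i<c)) (trans eq (S≗ j<c))))
    (λ c<k v<n king d → let i , i<c , eq = complete F c<k v<n king (from v<n d) in
      i , i<c , trans (S≗ i<c) eq)
    where
    sound′ : ∀ {i} → i < c → S′ i < n × King n a (S′ i) × Done′ (S′ i)
    sound′ i<c rewrite S≗ i<c = let s<n , king , d = sound F i<c in s<n , king , to s<n d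

  -- A king may be passed over once the list is full, since completeness is claimed only for
  -- `c < k`.
  found-skip : ∀ {S c v} {Done Done′ : ℕ → Set} → (c < k → ¬ King n a v) →
               (∀ {u} → u < n → Done u → Done′ u) → (∀ {u} → u < n → Done′ u → Done u ⊎ u ≡ v) →
               Found n a k S c Done → Found n a k S c Done′
  found-skip {S} {c} {Done′ = Done′} ¬king to from F = found (count≤ F)
    (λ i<c → let s<n , king , d = sound F i<c in s<n , king , to s<n d)
    (distinct F) complete′
    where
    complete′ : c < k → ∀ {u} → u < n → King n a u → Done′ u → ∃ λ i → i < c × S i ≡ u
    complete′ c<k u<n king d with from u<n d
    ... | inj₁ d′   = complete F c<k u<n king d′
    ... | inj₂ refl = contradiction king (¬king c<k)

  -- The new entry differs from the old ones because those are all `Done` and `v` is not.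
  found-add : ∀ {S S′ c v} {Done Done′ : ℕ → Set} → v < n → King n a v → c < k → ¬ Done v →
              (∀ {u} → u < n → Done u → Done′ u) → Done′ v →
              (∀ {u} → u < n → Done′ u → Done u ⊎ u ≡ v) →
              (∀ {i} → i < c → S′ i ≡ S i) → S′ c ≡ v →
              Found n a k S c Done → Found n a k S′ (suc c) Done′
  found-add {S} {S′} {c} {v} {Done} {Done′} v<n kingv c<k ¬dv to dv from S≗ S′c F =
    found c<k sound′ distinct′ complete′
    where
    old : ∀ {i} → i < suc c → i < c ⊎ i ≡ c
    old i<1+c = m≤n⇒m<n∨m≡n (≤-pred i<1+c)
    new : ∀ {i} → i < c → S′ i ≢ v
    new i<c eq = ¬dv (subst Done (trans (sym (S≗ i<c)) eq) (proj₂ (proj₂ (sound F i<c))))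
    sound′ : ∀ {i} → i < suc c → S′ i < n × King n a (S′ i) × Done′ (S′ i)
    sound′ i<1+c with old i<1+c
    ... | inj₂ refl rewrite S′c = v<n , kingv , dv
    ... | inj₁ i<c rewrite S≗ i<c = let s<n , king , d = sound F i<c in s<n , king , to s<n d
    distinct′ : ∀ {i j} → i < suc c → j < suc c → S′ i ≡ S′ j → i ≡ j
    distinct′ i< j< eq with old i< | old j<
    ... | inj₁ i<c  | inj₁ j<c  = distinct F i<c j<c (trans (sym (S≗ i<c)) (trans eq (S≗ j<c)))
    ... | inj₁ i<c  | inj₂ refl = contradiction (trans eq S′c) (new i<c)
    ... | inj₂ refl | inj₁ j<c  = contradiction (trans (sym eq) S′c) (new j<c)
    ... | inj₂ refl | inj₂ refl = refl
    complete′ : suc c < k → ∀ {u} → u < n → King n a u → Done′ u → ∃ λ i → i < suc c × S′ i ≡ u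
    complete′ _ u<n king d with from u<n d
    ... | inj₂ refl = c , ≤-refl , S′c
    ... | inj₁ d′ = let i , i<c , eq = complete F c<k u<n king d′ in
      i , m≤n⇒m≤1+n i<c , trans (S≗ i<c) eq

Flag : ℕ → Set → Set
Flag x A = (x ≡ 1 × A) ⊎ (x ≡ 0 × ¬ A)

flag-map : ∀ {x A B} → (A → B) → (B → A) → Flag x A → Flag x B
flag-map f g (inj₁ (e , a))  = inj₁ (e , f a)
flag-map f g (inj₂ (e , ¬a)) = inj₂ (e , λ b → ¬a (g b))

flag-yes : ∀ {x A} → Flag x A → 0 < x → A
flag-yes (inj₁ (_ , a))    _ = a
flag-yes (inj₂ (refl , _)) ()

flag-no : ∀ {x A} → Flag x A → x ≤ 0 → ¬ A
flag-no (inj₁ (refl , _)) ()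
flag-no (inj₂ (_ , ¬a)) _ = ¬a

-- Registers 0 to 6 and 22 are fixed by setup.  Throughout, register 9 counts the
-- recorded kings, 10 is the vertex examined and 12 flags whether it is a king.
Base : ℕ → ℕ → ℕ → Regs → Set
Base n k P R = R 0 ≡ 0 × R 1 ≡ 1 × R 2 ≡ n × R 3 ≡ k × R 4 ≡ n * n × R 5 ≡ n * n + 3 ×
               R 6 ≡ P × R 22 ≡ n * n + 2

Found-in : (n : ℕ) → (ℕ → ℕ → ℕ) → ℕ → Mem → ℕ → (ℕ → Set) → Set
Found-in n a k M = Found n a k (λ i → M (n * n + 3 + i))

-- Agreement outside the block where kings are recorded.
Frame : ℕ → ℕ → Mem → Mem → Set
Frame n k M M₀ = ∀ {x} → x < n * n + 3 ⊎ n * n + 3 + k ≤ x → M x ≡ M₀ x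

-- Only success is written by `finish`: the cell is blank before, and `0` is already the encoding of
-- ⊥.
append finish : Cmd
append = ifLt 0 12 (ifLt 9 3 (prim (arith add 13 5 9) ⨾ prim (store 13 10) ⨾ prim (arith add 9 9 1) ⨾ skip) skip) skip
finish = ifLt 9 3 skip (prim (store 22 1) ⨾ skip)

Answer : (n : ℕ) → (ℕ → ℕ → ℕ) → ℕ → Mem → Set
Answer n a k M = ∃ λ c → Found-in n a k M c (_< n) ×
  ((c ≡ k × M (n * n + 2) ≡ 1) ⊎ (c < k × M (n * n + 2) ≡ 0))

module _ {w n : ℕ} {a : ℕ → ℕ → ℕ} {k P : ℕ} (fits : n * n + 3 + k < 2 ^ w) where

  -- The continuation `K` learns that the registers from 14 on are unchanged, since both methods
  -- keep loop data there.
  append-exec : ∀ {R M M₀ c v} {Done Done′ : ℕ → Set} {Q : Regs → Mem → Set} → Base n k P R →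
    R 9 ≡ c → R 10 ≡ v → Flag (R 12) (King n a v) → v < n →
    ¬ Done v → (∀ {u} → u < n → Done u → Done′ u) → Done′ v →
    (∀ {u} → u < n → Done′ u → Done u ⊎ u ≡ v) →
    Frame n k M M₀ → Found-in n a k M c Done →
    (∀ {R′ M′} c′ → Base n k P R′ → R′ 9 ≡ c′ → R′ 10 ≡ v → (∀ i → R′ (14 + i) ≡ R (14 + i)) →
       Frame n k M′ M₀ → Found-in n a k M′ c′ Done′ → Q R′ M′) →
    Exec w append R M 7 Q
  append-exec {R} {M} {M₀} {c} {v} {Done} {Done′} base@(b0 , b1 , b2 , b3 , b4 , b5 , b6 , b22) r9 r10 flag v<n ¬dv to dv from frame F K =
    ifLt! {R = R} {t = 5} b0 refl
      (λ pos → ifLt! r9 b3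
        (λ c<k →
          let addr<W : n * n + 3 + c < 2 ^ w
              addr<W = <-trans (+-monoʳ-< (n * n + 3) c<k) fits
          in add! b5 r9 addr<W (store! refl r10
            (add! r9 b1 (≤-<-trans (≤-trans (≤-reflexive (+-comm c 1)) (≤-trans c<k (m≤n+m k (n * n + 3)))) fits)
              (done (K (c + 1) base refl r10 (λ i → refl) (frame′ c<k)
                (subst (λ c′ → Found-in n a k (M [ n * n + 3 + c ↦ v ]) c′ Done′) (+-comm 1 c)
                  (found-add v<n (flag-yes flag pos) c<k ¬dv to dv from
                    (λ {i} i<c → update-other M (n * n + 3 + c) (λ eq → <⇒≢ i<c (+-cancelˡ-≡ (n * n + 3) i c eq)))
                    (update-same M (n * n + 3 + c) refl) F)))))))
        (λ k≤c → done (K c base r9 r10 (λ _ → refl) frame (found-skip (λ c<k → contradiction k≤c (<⇒≱ c<k)) to from F))))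
      (λ z → done (K c base r9 r10 (λ _ → refl) frame (found-skip (λ _ → flag-no flag z) to from F)))
    where
    frame′ : c < k → Frame n k (M [ n * n + 3 + c ↦ v ]) M₀
    frame′ c<k {x} out = trans (update-other M (n * n + 3 + c) (ne out)) (frame out)
      where
      ne : x < n * n + 3 ⊎ n * n + 3 + k ≤ x → x ≢ n * n + 3 + c
      ne (inj₁ lt) refl = contradiction lt (≤⇒≯ (m≤m+n (n * n + 3) c))
      ne (inj₂ ge) refl = contradiction (+-cancelˡ-≤ (n * n + 3) k c ge) (<⇒≱ c<k)

  finish-exec : ∀ {R M M₀ c} {Q : Regs → Mem → Set} → Base n k P R → R 9 ≡ c →
    Frame n k M M₀ → M₀ (n * n + 2) ≡ 0 → Found-in n a k M c (_< n) →
    (∀ {R′ M′} → Answer n a k M′ → Q R′ M′) → Exec w finish R M 3 Q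
  finish-exec {R} {M} {c = c} (b0 , b1 , b2 , b3 , b4 , b5 , b6 , b22) r9 frame blank F K = ifLt! r9 b3
    (λ c<k → done (K (c , F , inj₂ (c<k , trans (frame (inj₁ (+-monoʳ-< (n * n) ≤-refl))) blank))))
    (λ k≤c → store! b22 b1 (done (K (c ,
      found-cong (λ {i} _ → update-other M (n * n + 2)
          (λ eq → <⇒≢ (+-monoʳ-< (n * n) {2} {3 + i} (s≤s (s≤s (s≤s z≤n)))) (sym (trans (sym (+-assoc (n * n) 3 i)) eq))))
        (λ _ d → d) (λ _ d → d) F ,
      inj₁ (≤-antisym (count≤ F) k≤c , update-same M (n * n + 2) refl)))))

-- Testing vertices against the adjacency matrix and its square

entry-< : ∀ {n u v} → u < n → v < n → u * n + v < n * n
entry-< {n} {u} {v} u<n v<n = begin-strict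
  u * n + v  <⟨ +-monoʳ-< (u * n) v<n ⟩
  u * n + n  ≡⟨ +-comm (u * n) n ⟩
  suc u * n  ≤⟨ *-monoˡ-≤ n u<n ⟩
  n * n      ∎
  where open ≤-Reasoning

n≤n*n : ∀ n → n ≤ n * n
n≤n*n zero    = z≤n
n≤n*n (suc m) = m≤m*n (suc m) (suc m)

address-< : ∀ {n u v} B → u < n → v < n → u * n + B + v < B + n * n
address-< {n} {u} {v} B u<n v<n = subst (_< B + n * n)
  (trans (sym (+-assoc B (u * n) v)) (cong (_+ v) (+-comm B (u * n))))
  (+-monoʳ-< B (entry-< u<n v<n))

Below : ℕ → (ℕ → Set) → Set
Below j P = ∀ u → u < j → P u

below-suc : ∀ {P : ℕ → Set} {j} → P j → Below j P → Below (suc j) P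
below-suc pj h u u<1+j with m≤n⇒m<n∨m≡n (≤-pred u<1+j)
... | inj₁ u<j  = h u u<j
... | inj₂ refl = pj

below-pred : ∀ {P : ℕ → Set} {j} → Below (suc j) P → Below j P
below-pred h u u<j = h u (m≤n⇒m≤1+n u<j)

flag-keep : ∀ {x j} {P : ℕ → Set} → P j → Flag x (Below j P) → Flag x (Below (suc j) P)
flag-keep pj = flag-map (below-suc pj) below-pred

flag-clear : ∀ {j} {P : ℕ → Set} → ¬ P j → Flag 0 (Below (suc j) P)
flag-clear {j} ¬pj = inj₂ (refl , λ h → ¬pj (h j ≤-refl))

-- Registers 14 and 15 point to the rows of the vertex examined in the adjacency
-- matrix and in its square.
checkPair byProduct : Cmd
checkPair =
  prim (arith add 16 14 11) ⨾ prim (load 16 16) ⨾ prim (arith add 17 15 11) ⨾ prim (load 17 17) ⨾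
  ifLt 0 16 skip (ifLt 0 17 skip (ifLt 10 11 (prim (const 12 0) ⨾ skip) (ifLt 11 10 (prim (const 12 0) ⨾ skip) skip)))
byProduct =
  prim (const 9 0) ⨾ prim (arith add 20 6 1) ⨾ prim (arith add 20 20 4) ⨾ prim (arith add 20 20 4) ⨾
  for 10 2
    (prim (const 12 1) ⨾ prim (const 13 2) ⨾ prim (arith mul 14 10 2) ⨾
     prim (arith add 15 14 20) ⨾ prim (arith add 14 14 13) ⨾
     for 11 2 checkPair ⨾ append) ⨾
  finish

byProduct-time : ℕ → ℕ
byProduct-time n = 4 + ((n * ((5 + ((n * (13 + 3) + 3) + 7)) + 3) + 3) + 3)

module _ {w n : ℕ} {a b : ℕ → ℕ → ℕ} {k P : ℕ} (T : IsTournament n a)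
         (product : ∀ {u v} → u < n → v < n → (0 < b u v → ∃ λ x → x < n × a u x ≡ 1 × a x v ≡ 1) ×
                                               ((∃ λ x → x < n × a u x ≡ 1 × a x v ≡ 1) → 0 < b u v))
         (fits : n * n + 3 + k ≤ P + 1 + n * n + n * n) (fits′ : P + 1 + n * n + n * n + n * n < 2 ^ w)
  where

  private
    -- The simulated memory starts at `P`. Its input consists of `n` and two copies of the matrix,
    -- `1 + 2 n²` cells, and the product follows. The bound `fits` keeps the recorded kings clear of
    -- the product while it is still being read.
    pb : ℕ
    pb = P + 1 + n * n + n * n

    Reaches : ℕ → ℕ → Set
    Reaches v u = u ≡ v ⊎ 0 < a v u ⊎ 0 < b v u

    reaches⇒king : ∀ {v} → v < n → Below n (Reaches v) → King n a v
    reaches⇒king v<n h u u<n u≢v with h u u<n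
    ... | inj₁ u≡v         = contradiction u≡v u≢v
    ... | inj₂ (inj₁ vu)   = inj₁ (≤-antisym (entry≤1 T v<n u<n) vu)
    ... | inj₂ (inj₂ path) = inj₂ (proj₁ (product v<n u<n) path)

    king⇒reaches : ∀ {v} → v < n → King n a v → Below n (Reaches v)
    king⇒reaches {v} v<n king u u<n with u ≟ v
    ... | yes u≡v = inj₁ u≡v
    ... | no u≢v with king u u<n u≢v
    ... | inj₁ vu   = inj₂ (inj₁ (≤-reflexive (sym vu)))
    ... | inj₂ path = inj₂ (inj₂ (proj₂ (product v<n u<n) path))

    fits″ : n * n + 3 + k < 2 ^ w
    fits″ = ≤-<-trans (≤-trans fits (m≤m+n pb (n * n))) fits′

    small : ∀ {x} → x ≤ n * n + 3 → x < 2 ^ w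
    small le = ≤-<-trans (≤-trans le (m≤m+n (n * n + 3) k)) fits″

    below-pb : ∀ {x} → x ≤ pb → x < 2 ^ w
    below-pb le = ≤-<-trans (≤-trans le (m≤m+n pb (n * n))) fits′

    2≤pb : 2 ≤ pb
    2≤pb = ≤-trans (≤-trans (m≤n+m 2 (n * n)) (+-monoʳ-≤ (n * n) (s≤s (s≤s z≤n))))
                   (≤-trans (m≤m+n (n * n + 3) k) fits)

    address-bound : ∀ {u v} B → B ≤ pb → u < n → v < n → u * n + B + v < 2 ^ w
    address-bound B B≤pb u<n v<n =
      <-trans (address-< B u<n v<n) (≤-<-trans (+-monoˡ-≤ (n * n) B≤pb) fits′)

    row-bound : ∀ {u} B → B ≤ pb → u < n → u * n + B < 2 ^ w
    row-bound {u} B B≤pb u<n = ≤-<-trans (m≤m+n _ u) (address-bound B B≤pb u<n u<n)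

  byProduct-exec : ∀ {R M Q} → Base n k P R →
    (∀ {u v} → u < n → v < n → M (u * n + 2 + v) ≡ a u v) →
    (∀ {u v} → u < n → v < n → M (u * n + pb + v) ≡ b u v) →
    M (n * n + 2) ≡ 0 →
    (∀ {R′ M′} → Answer n a k M′ → Q R′ M′) →
    Exec w byProduct R M (byProduct-time n) Q
  byProduct-exec {R₀} {M₀} {Q} base₀@(c0 , c1 , c2 , c3 , c4 , c5 , c6 , c22) entryA entryB blank K =
    const! (small z≤n)
    (add! c6 c1 (below-pb (≤-trans (m≤m+n (P + 1) (n * n)) (m≤m+n _ (n * n))))
    (add! refl c4 (below-pb (m≤m+n _ (n * n)))
    (add! refl c4 (below-pb ≤-refl)
    (seq {t = n * ((5 + ((n * (13 + 3) + 3) + 7)) + 3) + 3}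
      (for! n (5 + ((n * (13 + 3) + 3) + 7)) Outer (small (≤-trans (n≤n*n n) (m≤m+n (n * n) 3)))
        (λ ((b0 , b1 , b2 , _) , r10 , _) → b1 , b2 , r10)
        (base₀ , refl , refl , (λ _ → refl) , 0 , refl , found-none λ _ ())
        (λ v v<n (base , r10 , r20 , frame , c , r9 , F) → outer v<n base r10 r20 frame r9 F)
        (λ (base , r10 , r20 , frame , c , r9 , F) → finish-exec {P = P} fits″ base r9 frame blank F K))))))
    where
    Outer : ℕ → Regs → Mem → Set
    Outer v R M = Base n k P R × R 10 ≡ v × R 20 ≡ pb × Frame n k M M₀ ×
      ∃ λ c → R 9 ≡ c × Found-in n a k M c (_< v)

    Inner : Mem → ℕ → ℕ → ℕ → Regs → Mem → Set
    Inner M₁ c v j R M = Base n k P R × R 9 ≡ c × R 10 ≡ v × R 11 ≡ j × R 14 ≡ v * n + 2 ×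
      R 15 ≡ v * n + pb × R 20 ≡ pb × Flag (R 12) (Below j (Reaches v)) × M ≡ M₁

    inner : ∀ {M c v j R} → v < n → j < n → Frame n k M M₀ → Inner M c v j R M →
      Exec w checkPair R M 13 (λ R′ M′ → (R′ 1 ≡ 1 × R′ 11 ≡ j) × Inner M c v (suc j) (R′ [ 11 ↦ suc j ]) M′)
    inner {M} {v = v} {j} v<n j<n frame (base@(b0 , b1 , _) , r9 , r10 , r11 , r14 , r15 , r20 , flag , refl) =
      add! r14 r11 (address-bound 2 2≤pb v<n j<n)
      (load! refl (trans (frame (inj₁ inA)) (entryA v<n j<n))
      (add! r15 r11 (address-bound pb ≤-refl v<n j<n)
      (load! refl (trans (frame (inj₂ inB)) (entryB v<n j<n))
      (ifLt! b0 refl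
        (λ vj → done ((b1 , r11) , base , r9 , r10 , refl , r14 , r15 , r20 , flag-keep (inj₂ (inj₁ vj)) flag , refl))
      λ ¬vj → ifLt! b0 refl
        (λ path → done ((b1 , r11) , base , r9 , r10 , refl , r14 , r15 , r20 , flag-keep (inj₂ (inj₂ path)) flag , refl))
      λ ¬path → ifLt! {t = 3} r10 r11
        (λ v<j → const! (small z≤n) (done ((b1 , r11) , base , r9 , r10 , refl , r14 , r15 , r20 ,
           flag-clear (λ { (inj₁ eq) → <⇒≢ v<j (sym eq) ; (inj₂ (inj₁ p)) → ≤⇒≯ ¬vj p ; (inj₂ (inj₂ p)) → ≤⇒≯ ¬path p }) , refl)))
      λ j≤v → ifLt! r11 r10
        (λ j<v → const! (small z≤n) (done ((b1 , r11) , base , r9 , r10 , refl , r14 , r15 , r20 ,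
           flag-clear (λ { (inj₁ eq) → <⇒≢ j<v eq ; (inj₂ (inj₁ p)) → ≤⇒≯ ¬vj p ; (inj₂ (inj₂ p)) → ≤⇒≯ ¬path p }) , refl)))
        (λ v≤j → done ((b1 , r11) , base , r9 , r10 , refl , r14 , r15 , r20 , flag-keep (inj₁ (≤-antisym j≤v v≤j)) flag , refl)))
      )))
      where
      inA : v * n + 2 + j < n * n + 3
      inA = <-≤-trans (address-< 2 v<n j<n) (≤-trans (≤-reflexive (+-comm 2 (n * n))) (+-monoʳ-≤ (n * n) (s≤s (s≤s z≤n))))
      inB : n * n + 3 + k ≤ v * n + pb + j
      inB = ≤-trans fits (≤-trans (m≤n+m pb (v * n)) (m≤m+n _ j))

    outer : ∀ {R M c v} → v < n → Base n k P R → R 10 ≡ v → R 20 ≡ pb → Frame n k M M₀ → R 9 ≡ c →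
      Found-in n a k M c (_< v) →
      Exec w _ R M (5 + ((n * (13 + 3) + 3) + 7))
        (λ R′ M′ → (R′ 1 ≡ 1 × R′ 10 ≡ v) × Outer (suc v) (R′ [ 10 ↦ suc v ]) M′)
    outer {R} {M} {c} {v} v<n base@(b0 , b1 , b2 , _) r10 r20 frame r9 F =
      const! (small (≤-trans (s≤s z≤n) (m≤n+m 3 (n * n))))
      (const! (small (≤-trans (s≤s (s≤s z≤n)) (m≤n+m 3 (n * n))))
      (mul! r10 b2 (≤-<-trans (m≤m+n (v * n) pb) (row-bound pb ≤-refl v<n))
      (add! refl r20 (row-bound pb ≤-refl v<n)
      (add! refl refl (row-bound 2 2≤pb v<n)
      (seq {t = n * (13 + 3) + 3}
        (for! n 13 (Inner M c v) (small (≤-trans (n≤n*n n) (m≤m+n (n * n) 3)))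
          (λ ((_ , b1 , b2 , _) , _ , _ , r11 , _) → b1 , b2 , r11)
          (base , r9 , r10 , refl , refl , refl , r20 , inj₁ (refl , λ _ ()) , refl)
          (λ { j j<n i@(_ , _ , _ , _ , _ , _ , _ , _ , refl) → inner v<n j<n frame i })
          λ { (base , r9 , r10 , r11 , r14 , r15 , r20 , flag , refl) →
            append-exec {P = P} fits″ base r9 r10 (flag-map (reaches⇒king v<n) (king⇒reaches v<n) flag) v<n
              (<-irrefl refl) (λ _ → m≤n⇒m≤1+n) ≤-refl (λ _ u<1+v → m≤n⇒m<n∨m≡n (≤-pred u<1+v)) frame F
              λ c′ base′ r9′ r10′ same frame′ F′ →
                (proj₁ (proj₂ base′) , r10′) , base′ , refl , trans (same 6) r20 , frame′ , c′ , r9′ , F′ }))))))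

-- Testing vertices in order of their co-outdegree

∑-+ : ∀ n (f g : ℕ → ℕ) → ∑ n (λ i → f i + g i) ≡ ∑ n f + ∑ n g
∑-+ zero    f g = refl
∑-+ (suc n) f g = begin
  ∑ n (λ i → f i + g i) + (f n + g n)  ≡⟨ cong (_+ (f n + g n)) (∑-+ n f g) ⟩
  ∑ n f + ∑ n g + (f n + g n)          ≡⟨ +-assoc (∑ n f) (∑ n g) _ ⟩
  ∑ n f + (∑ n g + (f n + g n))        ≡⟨ cong (∑ n f +_) (x∙yz≈y∙xz (∑ n g) (f n) (g n)) ⟩
  ∑ n f + (f n + (∑ n g + g n))        ≡⟨ +-assoc (∑ n f) (f n) _ ⟨
  ∑ n f + f n + (∑ n g + g n)          ∎
  where
  open ≡-Reasoning
  open import Algebra.Properties.CommutativeSemigroup +-commutativeSemigroup using (x∙yz≈y∙xz)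

∑-swap : ∀ m n (f : ℕ → ℕ → ℕ) → ∑ m (λ i → ∑ n (f i)) ≡ ∑ n (λ j → ∑ m (λ i → f i j))
∑-swap m zero    f = trans (∑-const m 0) (*-zeroʳ m)
∑-swap m (suc n) f =
  trans (∑-+ m (λ i → ∑ n (f i)) (λ i → f i n)) (cong (_+ ∑ m (λ i → f i n)) (∑-swap m n f))

-- An amount `t` charged at a single index: below for the one level at which a vertex is tested,
-- later for the one cell that a store can change.
onDiagonal : ℕ → ℕ → ℕ → ℕ
onDiagonal t x y = if x ≡ᵇ y then t else 0

onDiagonal-≡ : ∀ t {x y} → x ≡ y → onDiagonal t x y ≡ t
onDiagonal-≡ t {x} {y} eq with x ≡ᵇ y | ≡⇒≡ᵇ x y eq
... | true | _ = refl

onDiagonal-≢ : ∀ t {x y} → x ≢ y → onDiagonal t x y ≡ 0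
onDiagonal-≢ t {x} {y} ne with x ≡ᵇ y | ≡ᵇ⇒≡ x y
... | false | _ = refl
... | true  | f = contradiction (f _) ne

∑-onDiagonal : ∀ m t x → ∑ m (onDiagonal t x) ≤ t
∑-onDiagonal zero    t x = z≤n
∑-onDiagonal (suc m) t x with x ≟ m
... | no x≢m = subst (_≤ t) (sym (trans (cong (∑ m (onDiagonal t x) +_) (onDiagonal-≢ t x≢m)) (+-identityʳ _)))
                 (∑-onDiagonal m t x)
... | yes refl = ≤-reflexive (cong₂ _+_ (before m ≤-refl) (onDiagonal-≡ t {m} refl))
  where
  before : ∀ j → j ≤ m → ∑ j (onDiagonal t m) ≡ 0
  before zero    _   = refl
  before (suc j) j<m = cong₂ _+_ (before j (<⇒≤ j<m)) (onDiagonal-≢ t (λ eq → <⇒≢ j<m (sym eq)))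

-- Exchanging the sums shows that `t` is paid at most once for each `j`, thus `n * t` and not
-- `m * n * t`. With `t` of order `k * n` this gives the bound for the second method.
∑-diagonal : ∀ m n c c′ t (D : ℕ → ℕ) →
  ∑ m (λ i → ∑ n (λ j → c + onDiagonal t (D j) i) + c′) ≤ m * (n * c + c′) + n * t
∑-diagonal m n c c′ t D = begin
  ∑ m (λ i → ∑ n (λ j → c + e i j) + c′)            ≤⟨ ∑-mono m (λ i _ → ≤-reflexive (split i)) ⟩
  ∑ m (λ i → (n * c + c′) + ∑ n (e i))              ≡⟨ ∑-+ m (λ _ → n * c + c′) (λ i → ∑ n (e i)) ⟩
  ∑ m (λ _ → n * c + c′) + ∑ m (λ i → ∑ n (e i))    ≡⟨ cong₂ _+_ (∑-const m (n * c + c′)) (∑-swap m n e) ⟩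
  m * (n * c + c′) + ∑ n (λ j → ∑ m (onDiagonal t (D j)))
    ≤⟨ +-monoʳ-≤ (m * (n * c + c′)) (∑-mono n λ j _ → ∑-onDiagonal m t (D j)) ⟩
  m * (n * c + c′) + ∑ n (λ _ → t)                  ≡⟨ cong (m * (n * c + c′) +_) (∑-const n t) ⟩
  m * (n * c + c′) + n * t                          ∎
  where
  open ≤-Reasoning
  e : ℕ → ℕ → ℕ
  e i j = onDiagonal t (D j) i
  split : ∀ i → ∑ n (λ j → c + e i j) + c′ ≡ (n * c + c′) + ∑ n (e i)
  split i = trans (cong (_+ c′) (trans (∑-+ n (λ _ → c) (e i)) (cong (_+ ∑ n (e i)) (∑-const n c))))
              (trans (+-assoc (n * c) _ c′) (trans (cong (n * c +_) (+-comm _ c′)) (sym (+-assoc (n * c) c′ _))))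

-- Register 18 is the co-outdegree whose vertices are examined, register 20 the
-- address of the co-outdegrees, and register 13 flags whether a recorded king
-- covers the vertex examined.
countNonSuccessors coOutdegrees compareRows checkCover checkUncovered byCovering : Cmd
countNonSuccessors =
  prim (arith add 16 14 11) ⨾ prim (load 16 16) ⨾ ifLt 0 16 skip (prim (arith add 12 1 12) ⨾ skip)
coOutdegrees =
  for 10 2
    (prim (const 12 0) ⨾ prim (const 13 2) ⨾ prim (arith mul 14 10 2) ⨾ prim (arith add 14 14 13) ⨾
     for 11 2 countNonSuccessors ⨾
     prim (arith add 16 20 10) ⨾ prim (store 16 12) ⨾ skip)
compareRows =
  prim (arith add 23 14 11) ⨾ prim (load 23 23) ⨾ prim (arith add 24 16 11) ⨾ prim (load 24 24) ⨾
  ifLt 24 23 (prim (const 13 0) ⨾ skip) skip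
checkCover =
  prim (arith add 15 5 17) ⨾ prim (load 15 15) ⨾ prim (arith mul 16 15 2) ⨾ prim (const 13 2) ⨾
  prim (arith add 16 16 13) ⨾ prim (arith add 13 16 10) ⨾ prim (load 13 13) ⨾
  for 11 2 compareRows ⨾
  ifLt 0 13 (prim (const 12 0) ⨾ skip) skip
checkUncovered =
  ifLt 9 3
    (prim (const 12 1) ⨾ prim (const 13 2) ⨾ prim (arith mul 14 10 2) ⨾ prim (arith add 14 14 13) ⨾
     for 17 9 checkCover ⨾ append)
    skip
byCovering =
  prim (const 9 0) ⨾ prim (arith add 20 5 2) ⨾ prim (arith add 19 2 1) ⨾
  coOutdegrees ⨾
  for 18 19
    (for 10 2
      (prim (arith add 16 20 10) ⨾ prim (load 16 16) ⨾ ifLt 16 18 skip (ifLt 18 16 skip checkUncovered))) ⨾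
  finish

coOutdegrees-time checkCover-time : ℕ → ℕ
coOutdegrees-time n = n * ((4 + ((n * (5 + 3) + 3) + 2)) + 3) + 3
checkCover-time n = 7 + ((n * (7 + 3) + 3) + 3)

checkUncovered-time byCovering-time : ℕ → ℕ → ℕ
checkUncovered-time n k = 2 + (4 + ((k * (checkCover-time n + 3) + 3) + 7))
byCovering-time n k =
  3 + (coOutdegrees-time n + (((n + 1) * (n * 9 + 6) + n * checkUncovered-time n k + 3) + 3))

module _ {w n : ℕ} {a : ℕ → ℕ → ℕ} {k P : ℕ} (T : IsTournament n a) (k≤n : k ≤ n)
         (fits : n * n + 3 + n + n < 2 ^ w)
  where

  private
    D : ℕ → ℕ
    D v = nonSuccessors (a v) n

    fits′ : n * n + 3 + k < 2 ^ w
    fits′ = ≤-<-trans (≤-trans (+-monoʳ-≤ (n * n + 3) k≤n) (m≤m+n _ n)) fits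

    small : ∀ {x} → x ≤ n * n + 3 → x < 2 ^ w
    small le = ≤-<-trans (≤-trans le (m≤m+n (n * n + 3) k)) fits′

    n<W : n < 2 ^ w
    n<W = small (≤-trans (n≤n*n n) (m≤m+n (n * n) 3))

    2<W : 2 < 2 ^ w
    2<W = small (≤-trans (s≤s (s≤s z≤n)) (m≤n+m 3 (n * n)))

    n+1<W : n + 1 < 2 ^ w
    n+1<W = small (+-mono-≤ (n≤n*n n) (s≤s z≤n))

    entry-input : ∀ {u v} → u < n → v < n → u * n + 2 + v < n * n + 3
    entry-input u<n v<n = <-≤-trans (address-< 2 u<n v<n)
      (≤-trans (≤-reflexive (+-comm 2 (n * n))) (+-monoʳ-≤ (n * n) (s≤s (s≤s z≤n))))

    entry<W : ∀ {u v} → u < n → v < n → u * n + 2 + v < 2 ^ w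
    entry<W u<n v<n = small (<⇒≤ (entry-input u<n v<n))

    row<W : ∀ {u} → u < n → u * n + 2 < 2 ^ w
    row<W {u} u<n = ≤-<-trans (m≤m+n _ u) (entry<W u<n u<n)

    row₀<W : ∀ {u} → u < n → u * n < 2 ^ w
    row₀<W {u} u<n = ≤-<-trans (m≤m+n _ 2) (row<W u<n)

    HasEntries : Mem → Set
    HasEntries M = ∀ {u v} → u < n → v < n → M (u * n + 2 + v) ≡ a u v

    -- The co-outdegrees are stored from this address on.
    db : ℕ
    db = n * n + 3 + n

    slot<W : ∀ {v} → v < n → db + v < 2 ^ w
    slot<W v<n = <-trans (+-monoʳ-< db v<n) fits

    Degrees : Mem → ℕ → Set
    Degrees M j = ∀ {v} → v < j → M (db + v) ≡ D v

    coOutdegrees-exec : ∀ {R M Q} → Base n k P R → R 9 ≡ 0 → R 19 ≡ n + 1 → R 20 ≡ db →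
      HasEntries M →
      (∀ {R′ M′} → Base n k P R′ → R′ 9 ≡ 0 → R′ 19 ≡ n + 1 → R′ 20 ≡ db →
        (∀ {x} → x < n * n + 3 → M′ x ≡ M x) → Degrees M′ n → Q R′ M′) →
      Exec w coOutdegrees R M (coOutdegrees-time n) Q
    coOutdegrees-exec {M = M₀} base₀ z₉ z₁₉ z₂₀ entries K =
      for! n (4 + ((n * (5 + 3) + 3) + 2)) Outer n<W
        (λ ((_ , b1 , b2 , _) , r10 , _) → b1 , b2 , r10)
        (base₀ , refl , z₉ , z₁₉ , z₂₀ , (λ _ → refl) , λ ())
        (λ v v<n i → outer v<n i)
        (λ (base , r10 , r9 , r19 , r20 , same , degrees) → K base r9 r19 r20 same degrees)
      where
      Outer : ℕ → Regs → Mem → Set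
      Outer v R M = Base n k P R × R 10 ≡ v × R 9 ≡ 0 × R 19 ≡ n + 1 × R 20 ≡ db ×
        (∀ {x} → x < n * n + 3 → M x ≡ M₀ x) × Degrees M v

      Inner : Mem → ℕ → ℕ → Regs → Mem → Set
      Inner M₁ v j R M = Base n k P R × R 10 ≡ v × R 9 ≡ 0 × R 19 ≡ n + 1 × R 20 ≡ db ×
        R 11 ≡ j × R 14 ≡ v * n + 2 × R 12 ≡ nonSuccessors (a v) j × M ≡ M₁

      inner : ∀ {R M v j} → v < n → j < n → HasEntries M → Inner M v j R M →
        Exec w countNonSuccessors R M 5 (λ R′ M′ → (R′ 1 ≡ 1 × R′ 11 ≡ j) × Inner M v (suc j) (R′ [ 11 ↦ suc j ]) M′)
      inner {R} {v = v} {j} v<n j<n ent (base@(b0 , b1 , _) , r10 , r9 , r19 , r20 , r11 , r14 , r12 , refl) =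
        add! r14 r11 (entry<W v<n j<n)
        (load! refl (ent v<n j<n)
        (ifLt! b0 refl
          (λ vj → done ((b1 , r11) , base , r10 , r9 , r19 , r20 , refl , r14 ,
            trans r12 (cong (_+ nonSuccessors (a v) j) (sym (m≤n⇒m∸n≡0 vj))) , refl))
          (λ ¬vj → add! b1 r12 (≤-<-trans (+-mono-≤ (s≤s z≤n) (≤-trans (nonSuccessors-≤ (a v) j) (<⇒≤ j<n)))
                                (subst (_< 2 ^ w) (+-comm n 1) n+1<W))
            (done ((b1 , r11) , base , r10 , r9 , r19 , r20 , refl , r14 ,
              cong (λ x → (1 ∸ x) + nonSuccessors (a v) j) (sym (n≤0⇒n≡0 ¬vj)) , refl)))))

      outer : ∀ {R M v} → v < n → Outer v R M →
        Exec w _ R M (4 + ((n * (5 + 3) + 3) + 2))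
          (λ R′ M′ → (R′ 1 ≡ 1 × R′ 10 ≡ v) × Outer (suc v) (R′ [ 10 ↦ suc v ]) M′)
      outer {R} {M} {v} v<n (base@(b0 , b1 , b2 , _) , r10 , r9 , r19 , r20 , same , degrees) =
        const! (small z≤n)
        (const! 2<W
        (mul! r10 b2 (row₀<W v<n)
        (add! refl refl (row<W v<n)
        (seq {t = n * (5 + 3) + 3}
          (for! n 5 (Inner M v) n<W
            (λ ((_ , b1 , b2 , _) , _ , _ , _ , _ , r11 , _) → b1 , b2 , r11)
            (base , r10 , r9 , r19 , r20 , refl , refl , refl , refl)
            (λ { j j<n i@(_ , _ , _ , _ , _ , _ , _ , _ , refl) → inner v<n j<n ent i })
            λ { (base@(_ , b1 , _) , r10 , r9 , r19 , r20 , r11 , r14 , r12 , refl) →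
              add! r20 r10 (slot<W v<n)
              (store! refl r12
              (done ((b1 , r10) , base , refl , r9 , r19 , r20 ,
                (λ {x} x<sb → trans (update-other M (db + v) λ { refl → ≤⇒≯ (≤-trans (m≤m+n (n * n + 3) n) (m≤m+n db v)) x<sb }) (same x<sb)) ,
                degrees′))) })))))
        where
        ent : HasEntries M
        ent u<n v<n = trans (same (entry-input u<n v<n)) (entries u<n v<n)
        degrees′ : Degrees (M [ db + v ↦ D v ]) (suc v)
        degrees′ {u} u<1+v with m≤n⇒m<n∨m≡n (≤-pred u<1+v)
        ... | inj₂ refl = update-same M (db + v) refl
        ... | inj₁ u<v  = trans (update-other M (db + v) (λ eq → <⇒≢ u<v (+-cancelˡ-≡ db u v eq))) (degrees u<v)

    -- The vertices preceding v in the order by co-outdegree when the vertices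
    -- of co-outdegree d are being examined.
    Before : ℕ → ℕ → ℕ → Set
    Before d v u = D u < d ⊎ (D u ≡ d × u < v)

    Uncovered : (ℕ → ℕ) → ℕ → ℕ → Set
    Uncovered S v i = ¬ Covers n a (S i) v

    -- A covered `v` is covered by some king, which has fewer non-successors and so was examined at
    -- an earlier level. As `c < k`, the list is complete and contains that king, contrary to the
    -- outcome of the tests.
    uncovered⇒king : ∀ {S c v} → v < n → c < k → Found n a k S c (Before (D v) v) →
                     Below c (Uncovered S v) → King n a v
    uncovered⇒king {S} {c} {v} v<n c<k F h with king∨covered T v<n
    ... | inj₁ king = king
    ... | inj₂ (u , u<n , uv) with covered⇒kingCovers T u<n v<n uv
    ... | t , t<n , kingt , tv with complete F c<k t<n kingt (inj₁ (covers⇒fewer T t<n v<n tv))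
    ... | i , i<c , refl = contradiction tv (h i i<c)

    king⇒uncovered : ∀ {S c v Done} → v < n → Found n a k S c Done → King n a v → Below c (Uncovered S v)
    king⇒uncovered v<n F king i i<c cov = covered⇒¬king T (proj₁ (sound F i<c)) v<n cov king

    CoversBelow : ℕ → ℕ → ℕ → Set
    CoversBelow s v j = a s v ≡ 1 × Below j (λ x → a v x ≤ a s x)

    Ctx : ℕ → ℕ → ℕ → Regs → Set
    Ctx d v c R = Base n k P R × R 9 ≡ c × R 10 ≡ v × R 18 ≡ d × R 19 ≡ n + 1 × R 20 ≡ db × R 14 ≡ v * n + 2

    checkCover-exec : ∀ {R M d v c i} → v < n → c ≤ k → i < c → HasEntries M → M (n * n + 3 + i) < n →
      Ctx d v c R → R 17 ≡ i → Flag (R 12) (Below i (Uncovered (λ i → M (n * n + 3 + i)) v)) →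
      Exec w checkCover R M (checkCover-time n) (λ R′ M′ → (R′ 1 ≡ 1 × R′ 17 ≡ i) × Ctx d v c R′ ×
        Flag (R′ 12) (Below (suc i) (Uncovered (λ i → M (n * n + 3 + i)) v)) × M′ ≡ M)
    checkCover-exec {R₀} {M} {d} {v} {c} {i} v<n c≤k i<c ent s<n
      ctx₀@((c0 , c1 , c2 , c3 , c4 , c5 , _) , _ , z10 , _) z17 flag₀ =
      add! c5 z17 (<-trans (+-monoʳ-< (n * n + 3) (<-≤-trans i<c c≤k)) fits′)
      (load! refl refl
      (mul! refl c2 (row₀<W s<n)
      (const! 2<W
      (add! refl refl (row<W s<n)
      (add! refl z10 (entry<W s<n v<n)
      (load! refl (ent s<n v<n)
      (seq {t = n * (7 + 3) + 3}
        (for! n 7 I n<W (λ (((_ , b1 , b2 , _) , _) , _ , _ , r11 , _) → b1 , b2 , r11)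
          (ctx₀ , z17 , flag₀ , refl , refl , initially , refl)
          (λ { j j<n i@(_ , _ , _ , _ , _ , _ , refl) → body j<n i })
          λ { (ctx@((b0 , b1 , _) , _) , r17 , flag , r11 , r16 , cflag , refl) →
            ifLt! b0 refl
              (λ pos → const! (small z≤n) (done ((b1 , r17) , ctx ,
                flag-clear (λ ¬cov → ¬cov (covers (flag-yes cflag pos))) , refl)))
              (λ zero → done ((b1 , r17) , ctx ,
                flag-keep (λ cov → flag-no cflag zero (covers⁻¹ cov)) flag , refl)) }))))))))
      where
      s : ℕ
      s = M (n * n + 3 + i)
      I : ℕ → Regs → Mem → Set
      I j R M′ = Ctx d v c R × R 17 ≡ i × Flag (R 12) (Below i (Uncovered (λ i → M (n * n + 3 + i)) v)) ×
        R 11 ≡ j × R 16 ≡ s * n + 2 × Flag (R 13) (CoversBelow s v j) × M′ ≡ M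
      covers : CoversBelow s v n → Covers n a s v
      covers (sv , h) = sv , λ {x} x<n → h x x<n
      covers⁻¹ : Covers n a s v → CoversBelow s v n
      covers⁻¹ (sv , h) = sv , λ x x<n → h x<n
      -- The entry `a s v` just loaded into register 13 is itself the initial flag; the comparison
      -- of the rows can only clear it.
      initially : Flag (a s v) (CoversBelow s v 0)
      initially with a s v | entry≤1 T s<n v<n
      ... | zero        | _ = inj₂ (refl , λ { (() , _) })
      ... | suc zero    | _ = inj₁ (refl , refl , λ _ ())
      ... | suc (suc _) | s≤s ()
      body : ∀ {R j} → j < n → I j R M →
        Exec w compareRows R M 7 (λ R′ M′ → (R′ 1 ≡ 1 × R′ 11 ≡ j) × I (suc j) (R′ [ 11 ↦ suc j ]) M′)
      body {R} {j} j<n (ctx@((b0 , b1 , _) , _ , _ , _ , _ , _ , r14) , r17 , flag , r11 , r16 , cflag , refl) =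
        add! r14 r11 (entry<W v<n j<n)
        (load! refl (ent v<n j<n)
        (add! r16 r11 (entry<W s<n j<n)
        (load! refl (ent s<n j<n)
        (ifLt! {t = 1} refl refl
          (λ lt → const! (small z≤n) (done ((b1 , r11) , ctx , r17 , flag , refl , r16 ,
             inj₂ (refl , λ (_ , h) → ≤⇒≯ (h j ≤-refl) lt) , refl)))
          (λ ge → done ((b1 , r11) , ctx , r17 , flag , refl , r16 ,
             flag-map (λ (sv , h) → sv , below-suc ge h) (λ (sv , h) → sv , below-pred h) cflag , refl))))))

    Examined : Mem → ℕ → ℕ → Regs → Mem → Set
    Examined M₁ d v R M = Base n k P R × R 10 ≡ v × R 18 ≡ d × R 19 ≡ n + 1 × R 20 ≡ db × Frame n k M M₁ ×
      ∃ λ c → R 9 ≡ c × Found-in n a k M c (Before d v)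

    checkUncovered-exec : ∀ {R M M₁ d v Q} → v < n → D v ≡ d → HasEntries M₁ → Examined M₁ d v R M →
      (∀ {R′ M′} → R′ 1 ≡ 1 → R′ 10 ≡ v → Examined M₁ d (suc v) (R′ [ 10 ↦ suc v ]) M′ → Q R′ M′) →
      Exec w checkUncovered R M (checkUncovered-time n k) Q
    checkUncovered-exec {R} {M} {M₁} {d} {v} v<n refl ent
      (base@(b0 , b1 , b2 , b3 , _) , r10 , r18 , r19 , r20 , frame , c , r9 , F) K =
      ifLt! {t = 4 + ((k * (checkCover-time n + 3) + 3) + 7)} r9 b3
        -- The loop runs through the `c` kings recorded so far, and its cost is rounded up from `c`
        -- to `k` rounds.
        (λ c<k → exec-mono (+-monoʳ-≤ 4 (+-monoˡ-≤ 7 (+-monoˡ-≤ 3 (*-monoˡ-≤ (checkCover-time n + 3) (<⇒≤ c<k))))) (λ q → q)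
          (const! (≤-<-trans (s≤s z≤n) 2<W)
          (const! 2<W
          (mul! r10 b2 (row₀<W v<n)
          (add! refl refl (row<W v<n)
          (seq {t = c * (checkCover-time n + 3) + 3}
            (for! c (checkCover-time n) I (<-trans (<-≤-trans c<k k≤n) n<W)
              (λ (((_ , b1 , _) , r9 , _) , r17 , _) → b1 , r9 , r17)
              ((base , r9 , r10 , r18 , r19 , r20 , refl) , refl , inj₁ (refl , λ _ ()) , refl)
              (λ { i i<c (ctx , r17 , flag , refl) →
                exec-mono ≤-refl (λ (step , ctx′ , flag′ , eq) → step , ctx′ , refl , flag′ , eq)
                  (checkCover-exec v<n (<⇒≤ c<k) i<c
                    (λ u<n v<n → trans (frame (inj₁ (entry-input u<n v<n))) (ent u<n v<n))
                    (proj₁ (sound F i<c)) ctx r17 flag) })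
              λ { ((base , r9 , r10 , r18 , r19 , r20 , r14) , r17 , flag , refl) →
                append-exec {P = P} fits′ base r9 r10
                  (flag-map (uncovered⇒king v<n c<k F) (king⇒uncovered v<n F) flag) v<n
                  (λ { (inj₁ lt) → <-irrefl refl lt ; (inj₂ (_ , lt)) → <-irrefl refl lt })
                  to (inj₂ (refl , ≤-refl)) from frame F
                  λ c′ base′ r9′ r10′ same frame′ F′ →
                    K (proj₁ (proj₂ base′)) r10′
                      (base′ , refl , trans (same 4) r18 , trans (same 5) r19 , trans (same 6) r20 ,
                       frame′ , c′ , r9′ , F′) })))))))
        (λ k≤c → done (K b1 r10 (base , refl , r18 , r19 , r20 , frame , c , r9 ,
          found-skip (λ c<k → contradiction k≤c (<⇒≱ c<k)) to from F)))
      where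
      I : ℕ → Regs → Mem → Set
      I i R M′ = Ctx d v c R × R 17 ≡ i × Flag (R 12) (Below i (Uncovered (λ i → M (n * n + 3 + i)) v)) × M′ ≡ M
      to : ∀ {u} → u < n → Before (D v) v u → Before (D v) (suc v) u
      to _ (inj₁ lt)        = inj₁ lt
      to _ (inj₂ (eq , lt)) = inj₂ (eq , m≤n⇒m≤1+n lt)
      from : ∀ {u} → u < n → Before (D v) (suc v) u → Before (D v) v u ⊎ u ≡ v
      from _ (inj₁ lt) = inj₁ (inj₁ lt)
      from _ (inj₂ (eq , lt)) with m≤n⇒m<n∨m≡n (≤-pred lt)
      ... | inj₁ u<v = inj₁ (inj₂ (eq , u<v))
      ... | inj₂ eq′ = inj₂ eq′

    examine-exec : ∀ {R M M₁ d v} → v < n → HasEntries M₁ → Degrees M₁ n → Examined M₁ d v R M →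
      Exec w (prim (arith add 16 20 10) ⨾ prim (load 16 16) ⨾ ifLt 16 18 skip (ifLt 18 16 skip checkUncovered)) R M
        (6 + onDiagonal (checkUncovered-time n k) (D v) d)
        (λ R′ M′ → (R′ 1 ≡ 1 × R′ 10 ≡ v) × Examined M₁ d (suc v) (R′ [ 10 ↦ suc v ]) M′)
    examine-exec {R} {M} {M₁} {d} {v} v<n ent degrees
      (base@(b0 , b1 , _) , r10 , r18 , r19 , r20 , frame , c , r9 , F) =
      add! r20 r10 (slot<W v<n)
      -- The co-outdegrees lie behind room for `n` kings, and `k ≤ n`, so recording has not
      -- overwritten them.
      (load! refl (trans (frame (inj₂ (≤-trans (+-monoʳ-≤ (n * n + 3) k≤n) (m≤m+n db v)))) (degrees v<n))
      (ifLt! refl r18 (λ lt → skipped (<⇒≢ lt))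
      λ d≤D → ifLt! r18 refl (λ lt → skipped (λ eq → <⇒≢ lt (sym eq)))
      λ D≤d → let D≡d = ≤-antisym D≤d d≤D in
        exec-mono (≤-reflexive (sym (onDiagonal-≡ (checkUncovered-time n k) D≡d))) (λ q → q)
          (checkUncovered-exec v<n D≡d ent (base , r10 , r18 , r19 , r20 , frame , c , r9 , F)
            λ g₁ g₁₀ ex → (g₁ , g₁₀) , ex)))
      where
      skipped : ∀ {t} → D v ≢ d →
        Exec w skip (R [ 16 ↦ db + v ] [ 16 ↦ D v ]) M t
          (λ R′ M′ → (R′ 1 ≡ 1 × R′ 10 ≡ v) × Examined M₁ d (suc v) (R′ [ 10 ↦ suc v ]) M′)
      skipped ne = done ((b1 , r10) , base , refl , r18 , r19 , r20 , frame , c , r9 ,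
        found-cong (λ _ → refl) (λ _ → to) (λ _ → from) F)
        where
        to : ∀ {u} → Before d v u → Before d (suc v) u
        to (inj₁ lt)        = inj₁ lt
        to (inj₂ (eq , lt)) = inj₂ (eq , m≤n⇒m≤1+n lt)
        from : ∀ {u} → Before d (suc v) u → Before d v u
        from (inj₁ lt) = inj₁ lt
        from (inj₂ (eq , lt)) with m≤n⇒m<n∨m≡n (≤-pred lt)
        ... | inj₁ u<v  = inj₂ (eq , u<v)
        ... | inj₂ refl = contradiction eq ne

  -- Co-outdegrees range over `0` to `n`, hence the `n + 1` levels; after the last one every vertex
  -- has been examined.
  byCovering-exec : ∀ {R M Q} → Base n k P R →
    (∀ {u v} → u < n → v < n → M (u * n + 2 + v) ≡ a u v) →
    M (n * n + 2) ≡ 0 →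
    (∀ {R′ M′} → Answer n a k M′ → Q R′ M′) →
    Exec w byCovering R M (byCovering-time n k) Q
  byCovering-exec {R₀} {M₀} base₀@(c0 , c1 , c2 , c3 , c4 , c5 , _) entries blank K =
    const! (small z≤n)
    (add! c5 c2 (≤-<-trans (m≤m+n _ n) fits)
    (add! c2 c1 n+1<W
    (seq {t = coOutdegrees-time n}
      (coOutdegrees-exec base₀ refl refl refl entries
        λ {_} {M₁} base r9 r19 r20 same degrees →
          seq {t = (n + 1) * (n * 9 + 6) + n * checkUncovered-time n k + 3}
            (exec-mono (+-monoˡ-≤ 3 time) (λ q → q)
              (for-sum! (n + 1) (λ d → ∑ n (visit d) + 3) (Outer M₁) n+1<W
                (λ ((_ , b1 , _) , r18 , r19 , _) → b1 , r19 , r18)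
                (base , refl , r19 , r20 , (λ _ → refl) , 0 , r9 , found-none λ _ ())
                (λ d _ (base , r18 , r19 , r20 , frame , c , r9 , F) →
                  for-sum! n (λ v → 6 + onDiagonal (checkUncovered-time n k) (D v) d) (Examined M₁ d) n<W
                    (λ ((_ , b1 , b2 , _) , r10 , _) → b1 , b2 , r10)
                    -- For vertices, `Before d 0` amounts to `D u < d`, and `Before d n` to
                    -- `D u < suc d`, so consecutive levels fit together.
                    (base , refl , r18 , r19 , r20 , frame , c , r9 ,
                      found-cong (λ _ → refl) (λ _ → inj₁) (λ { _ (inj₁ lt) → lt }) F)
                    (λ v v<n ex → examine-exec v<n (ent same) degrees ex)
                    λ (base , r10 , r18 , r19 , r20 , frame , c , r9 , F) →
                      (proj₁ (proj₂ base) , r18) , base , refl , r19 , r20 , frame , c , r9 ,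
                      found-cong (λ _ → refl)
                        (λ { _ (inj₁ lt) → m≤n⇒m≤1+n lt ; _ (inj₂ (eq , _)) → s≤s (≤-reflexive eq) })
                        (λ u<n lt → level u<n (m≤n⇒m<n∨m≡n (≤-pred lt))) F)
                λ (base , r18 , r19 , r20 , frame , c , r9 , F) →
                  finish-exec {P = P} fits′ base r9 frame
                    (trans (same (+-monoʳ-< (n * n) ≤-refl)) blank)
                    (found-cong (λ _ → refl) (λ u<n _ → u<n)
                      (λ {u} _ _ → ≤-<-trans (nonSuccessors-≤ (a u) n) (≤-reflexive (+-comm 1 n))) F) K))))))
    where
    Outer : Mem → ℕ → Regs → Mem → Set
    Outer M₁ d R M = Base n k P R × R 18 ≡ d × R 19 ≡ n + 1 × R 20 ≡ db × Frame n k M M₁ ×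
      ∃ λ c → R 9 ≡ c × Found-in n a k M c (λ u → D u < d)

    ent : ∀ {M₁} → (∀ {x} → x < n * n + 3 → M₁ x ≡ M₀ x) → HasEntries M₁
    ent same u<n v<n = trans (same (entry-input u<n v<n)) (entries u<n v<n)

    level : ∀ {d u} → u < n → D u < d ⊎ D u ≡ d → Before d n u
    level _   (inj₁ lt) = inj₁ lt
    level u<n (inj₂ eq) = inj₂ (eq , u<n)

    visit : ℕ → ℕ → ℕ
    visit d v = 6 + onDiagonal (checkUncovered-time n k) (D v) d + 3

    time : ∑ (n + 1) (λ d → ∑ n (visit d) + 3 + 3) ≤ (n + 1) * (n * 9 + 6) + n * checkUncovered-time n k
    time = ≤-trans
      (∑-mono (n + 1) λ d _ → ≤-trans (≤-reflexive (+-assoc (∑ n (visit d)) 3 3))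
        (+-monoˡ-≤ 6 (∑-mono n λ v _ → ≤-reflexive (+-comm (6 + onDiagonal (checkUncovered-time n k) (D v) d) 3))))
      (∑-diagonal (n + 1) n 9 6 (checkUncovered-time n k) D)

-- Simulation with a smaller word size and a step budget

2^1+w : ∀ w → 2 ^ suc w ≡ 2 ^ w + 2 ^ w
2^1+w w = cong (2 ^ w +_) (+-identityʳ (2 ^ w))

2^w<2^1+w : ∀ w → 2 ^ w < 2 ^ suc w
2^w<2^1+w w = subst (2 ^ w <_) (sym (2^1+w w)) (m<m+n (2 ^ w) (m^n>0 2 w))

wrap-wrap : ∀ w x → wrap w (wrap (suc w) x) ≡ wrap w x
wrap-wrap w x = m∣n⇒o%n%m≡o%m (2 ^ w) (2 ^ suc w) x {{m^n≢0 2 w}} {{m^n≢0 2 (suc w)}} (divides-refl 2)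

-- On the larger machine `2 ^ w` is itself a word, so a single `mod` instruction truncates to `w`
-- bits.
mod-power : ∀ w z → ⟦ mod ⟧ (suc w) z (2 ^ w) ≡ wrap w z
mod-power w z = go (2 ^ w) {{m^n≢0 2 w}} (<⇒≤ (2^w<2^1+w w))
  where
  go : ∀ y .{{_ : NonZero y}} → y ≤ 2 ^ suc w → ⟦ mod ⟧ (suc w) z y ≡ z % y
  go (suc y) y≤ = wrap-< (suc w) (<-≤-trans (m%n<n z (suc y)) y≤)

module _ (f : ℕ → ℕ → ℕ) (f≤1 : ∀ {x y} → x ≤ 1 → y ≤ 1 → f x y ≤ 1) where

  bitwise-< : ∀ w x y → bitwise f w x y < 2 ^ w
  bitwise-< zero    x y = s≤s z≤n
  bitwise-< (suc w) x y = begin-strict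
    f (x % 2) (y % 2) + 2 * bitwise f w (x / 2) (y / 2)
      ≤⟨ +-monoˡ-≤ _ (f≤1 (≤-pred (m%n<n x 2)) (≤-pred (m%n<n y 2))) ⟩
    1 + 2 * bitwise f w (x / 2) (y / 2)  <⟨ ≤-refl ⟩
    2 + 2 * bitwise f w (x / 2) (y / 2)  ≡⟨ *-suc 2 _ ⟨
    2 * suc (bitwise f w (x / 2) (y / 2))  ≤⟨ *-monoʳ-≤ 2 (bitwise-< w (x / 2) (y / 2)) ⟩
    2 * 2 ^ w ∎
    where open ≤-Reasoning

  -- The additional top bits of both arguments are zero, and `f` maps them to zero.
  bitwise-suc : f 0 0 ≡ 0 → ∀ w {x y} → x < 2 ^ w → y < 2 ^ w → bitwise f (suc w) x y ≡ bitwise f w x y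
  bitwise-suc f00 zero    (s≤s z≤n) (s≤s z≤n) = cong (_+ 0) f00
  bitwise-suc f00 (suc w) {x} {y} x< y< = cong (λ z → f (x % 2) (y % 2) + 2 * z)
    (bitwise-suc f00 w (half x<) (half y<))
    where
    half : ∀ {x} → x < 2 ^ suc w → x / 2 < 2 ^ w
    half {x} x< = m<n*o⇒m/o<n (subst (x <_) (*-comm 2 (2 ^ w)) x<)

  bitwise-mod : f 0 0 ≡ 0 → ∀ w {x y} → x < 2 ^ w → y < 2 ^ w → wrap w (bitwise f (suc w) x y) ≡ bitwise f w x y
  bitwise-mod f00 w {x} {y} x< y< = trans (cong (wrap w) (bitwise-suc f00 w x< y<)) (wrap-< w (bitwise-< w x y))

∣-∣≤1 : ∀ {x y} → x ≤ 1 → y ≤ 1 → ∣ x - y ∣ ≤ 1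
∣-∣≤1 {zero}  _ y≤1 = y≤1
∣-∣≤1 {suc x} {zero}  x≤1 _ = x≤1
∣-∣≤1 {suc x} {suc y} (s≤s z≤n) (s≤s z≤n) = z≤n

-- One operation and one truncation imitate any instruction on shorter words. Most operations differ
-- only in their final reduction, and `2 ^ w` divides `2 ^ suc w`; for `sub`, moreover, the two
-- borrows differ by `2 ^ w`.
op-wrap : ∀ o w {x y} → x < 2 ^ w → y < 2 ^ w → wrap w (⟦ o ⟧ (suc w) x y) ≡ ⟦ o ⟧ w x y
op-wrap add w {x} {y} x< y< = wrap-wrap w (x + y)
op-wrap sub w {x} {y} x< y< = begin
  wrap w (wrap (suc w) (x + (2 ^ suc w ∸ y)))  ≡⟨ wrap-wrap w _ ⟩
  wrap w (x + (2 ^ suc w ∸ y))                 ≡⟨ cong (λ z → wrap w (x + (z ∸ y))) (2^1+w w) ⟩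
  wrap w (x + (2 ^ w + 2 ^ w ∸ y))             ≡⟨ cong (λ z → wrap w (x + z)) (+-∸-comm (2 ^ w) (<⇒≤ y<)) ⟩
  wrap w (x + (2 ^ w ∸ y + 2 ^ w))             ≡⟨ cong (wrap w) (+-assoc x _ _) ⟨
  wrap w (x + (2 ^ w ∸ y) + 2 ^ w)             ≡⟨ [m+n]%n≡m%n _ (2 ^ w) {{m^n≢0 2 w}} ⟩
  wrap w (x + (2 ^ w ∸ y))                     ∎
  where open ≡-Reasoning
op-wrap mul w {x} {y} x< y< = wrap-wrap w (x * y)
op-wrap div w {x} {zero}  x< y< = wrap-< w (≤-<-trans z≤n x<)
op-wrap div w {x} {suc y} x< y< = wrap-wrap w (x / suc y)
op-wrap mod w {x} {zero}  x< y< = wrap-< w (≤-<-trans z≤n x<)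
op-wrap mod w {x} {suc y} x< y< = wrap-wrap w (x % suc y)
op-wrap and w x< y< = bitwise-mod _⊓_ (λ x≤1 _ → ≤-trans (m⊓n≤m _ _) x≤1) refl w x< y<
op-wrap or  w x< y< = bitwise-mod _⊔_ ⊔-lub refl w x< y<
op-wrap xor w x< y< = bitwise-mod ∣_-_∣ ∣-∣≤1 refl w x< y<
op-wrap shl w {x} {y} x< y< = wrap-wrap w (x * 2 ^ y)
op-wrap shr w {x} {y} x< y< = wrap-wrap w (_/_ x (2 ^ y) {{m^n≢0 2 y}})

sub-1 : ∀ {w x} → suc x < 2 ^ w → ⟦ sub ⟧ w (suc x) 1 ≡ x
sub-1 {w} {x} x< = begin
  wrap w (suc x + (2 ^ w ∸ 1))   ≡⟨ cong (wrap w) (+-suc x (2 ^ w ∸ 1)) ⟨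
  wrap w (x + suc (2 ^ w ∸ 1))   ≡⟨ cong (λ z → wrap w (x + z)) (m+[n∸m]≡n (m^n>0 2 w)) ⟩
  wrap w (x + 2 ^ w)             ≡⟨ [m+n]%n≡m%n x (2 ^ w) {{m^n≢0 2 w}} ⟩
  wrap w x                       ≡⟨ wrap-< w (<-trans ≤-refl x<) ⟩
  x                              ∎
  where open ≡-Reasoning

halted-stays : ∀ w p t σ → Halted p σ → run w p t σ ≡ σ
halted-stays w p zero    σ h = refl
halted-stays w p (suc t) σ h = trans (cong (λ i → run w p t (exec w i σ)) h) (halted-stays w p t σ h)

-- Control may leave the program, where `fetch` reads `halt`. Clamping labels to one appended `halt`
-- gives each label a block in the finite translation.
fetch-halt : ∀ p l → fetch (p ++ halt ∷ []) (l ⊓ length p) ≡ fetch p l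
fetch-halt []      l       rewrite ⊓-zeroʳ l = refl
fetch-halt (i ∷ p) zero    = refl
fetch-halt (i ∷ p) (suc l) = fetch-halt p l

fetch-≢halt : ∀ p l → fetch p l ≢ halt → l < length p
fetch-≢halt []      l       ne = contradiction refl ne
fetch-≢halt (i ∷ p) zero    ne = s≤s z≤n
fetch-≢halt (i ∷ p) (suc l) ne = s≤s (fetch-≢halt p l ne)

length-∷ʳ : ∀ (p : Program) i → length (p ++ i ∷ []) ≡ suc (length p)
length-∷ʳ []      i = refl
length-∷ʳ (_ ∷ p) i = cong suc (length-∷ʳ p i)

-- The simulated machine has words of w bits and lives in the upper half of the
-- memory of a machine with words of 1 + w bits; register r becomes 32 + r, and
-- register 6 holds 2 ^ w.  Register 7 holds the number of steps still to be
-- simulated before giving up at label ab; a simulated halt continues at label e.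
module Simulation (p : Program) (base e ab : Label) where

  -- Every block has exactly five instructions, three for the budget and two for the translation,
  -- padded where one suffices, so that labels translate by multiplication.
  target : Label → Label
  target l = (l ⊓ length p) * 5 + base

  translate : Instr → Program → Program
  translate (const r c)     is = const (32 + r) c ∷ arith mod (32 + r) (32 + r) 6 ∷ is
  translate (arith o r s t) is = arith o (32 + r) (32 + s) (32 + t) ∷ arith mod (32 + r) (32 + r) 6 ∷ is
  translate (load r s)      is = arith add 8 (32 + s) 6 ∷ load (32 + r) 8 ∷ is
  translate (store r s)     is = arith add 8 (32 + r) 6 ∷ store 8 (32 + s) ∷ is
  translate (jump l)        is = jump (target l) ∷ halt ∷ is
  translate (jlt r s l)     is = jlt (32 + r) (32 + s) (target l) ∷ const 8 0 ∷ is
  translate halt            is = jump e ∷ halt ∷ is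

  block : Label → Instr → Program → Program
  block l i is = jlt 0 7 (2 + l) ∷ jump ab ∷ arith sub 7 7 1 ∷ translate i is

  blocks : Label → Program → Program
  blocks l []       = []
  blocks l (i ∷ is) = block l i (blocks (5 + l) is)

  suffix-translate : ∀ {q l} i {is} → Suffix q l (translate i is) → Suffix q (2 + l) is
  suffix-translate (const _ _)     s = suffix-tail (suffix-tail s)
  suffix-translate (arith _ _ _ _) s = suffix-tail (suffix-tail s)
  suffix-translate (load _ _)      s = suffix-tail (suffix-tail s)
  suffix-translate (store _ _)     s = suffix-tail (suffix-tail s)
  suffix-translate (jump _)        s = suffix-tail (suffix-tail s)
  suffix-translate (jlt _ _ _)     s = suffix-tail (suffix-tail s)
  suffix-translate halt            s = suffix-tail (suffix-tail s)

  suffix-block : ∀ {q} l is j → j < length is → Suffix q l (blocks l is) →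
                 ∃ λ is′ → Suffix q (j * 5 + l) (block (j * 5 + l) (fetch is j) is′)
  suffix-block l (i ∷ is) zero    _         s = _ , s
  suffix-block {q} l (i ∷ is) (suc j) (s≤s j<) s =
    let is′ , s′ = suffix-block (5 + l) is j j< (suffix-translate i (suffix-tail (suffix-tail (suffix-tail s))))
    in is′ , subst (λ x → Suffix q x (block x (fetch is j) is′)) (trans (+-suc⁵ (j * 5)) refl) s′
    where
    +-suc⁵ : ∀ x → x + (5 + l) ≡ 5 + x + l
    +-suc⁵ x = trans (sym (+-assoc x 5 l)) (cong (_+ l) (+-comm x 5))

  -- Simulated addresses are register contents and thus below `2 ^ w` by `reg<`, so agreement of the
  -- memories is required only there.
  record Simulates (w n k : ℕ) (M₀ : Mem) (b : ℕ) (R M : ℕ → ℕ) (R′ : Regs) (M′ : Mem) : Set where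
    constructor simulates
    field
      own    : Base n k (2 ^ w) R′ × R′ 7 ≡ b
      reg≡   : ∀ r → R′ (32 + r) ≡ R r
      reg<   : ∀ r → R r < 2 ^ w
      lower≡ : ∀ {x} → x < 2 ^ w → M′ x ≡ M₀ x
      upper≡ : ∀ {x} → x < 2 ^ w → M′ (x + 2 ^ w) ≡ M x
      mem<   : ∀ x → M x < 2 ^ w

  open Simulates

  module _ {w n k : ℕ} {M₀ : Mem} where

    set-reg : ∀ {b R M R′ M′ R″ r v} → Simulates w n k M₀ b R M R′ M′ → v < 2 ^ w →
              (∀ r′ → r′ ≢ r → R″ (32 + r′) ≡ R′ (32 + r′)) → R″ (32 + r) ≡ v →
              Base n k (2 ^ w) R″ × R″ 7 ≡ b →
              Simulates w n k M₀ b (R [ r ↦ v ]) M R″ M′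
    set-reg {R = R} {R″ = R″} {r} {v} S v< other same own″ =
      simulates own″ reg≡′ reg<′ (lower≡ S) (upper≡ S) (mem< S)
      where
      reg≡′ : ∀ r′ → R″ (32 + r′) ≡ (R [ r ↦ v ]) r′
      reg≡′ r′ with r′ ≟ r
      ... | yes refl = trans same (sym (update-same R r refl))
      ... | no r′≢r  = trans (other r′ r′≢r) (trans (reg≡ S r′) (sym (update-other R r r′≢r)))
      reg<′ : ∀ r′ → (R [ r ↦ v ]) r′ < 2 ^ w
      reg<′ r′ with r′ ≡ᵇ r
      ... | true  = v<
      ... | false = reg< S r′

    set-mem : ∀ {b R M R′ M′ x v} → Simulates w n k M₀ b R M R′ M′ → x < 2 ^ w → v < 2 ^ w →
              Simulates w n k M₀ b R (M [ x ↦ v ]) R′ (M′ [ x + 2 ^ w ↦ v ])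
    set-mem {M = M} {M′ = M′} {x} {v} S x< v< =
      simulates (own S) (reg≡ S) (reg< S) lower≡′ upper≡′ mem<′
      where
      lower≡′ : ∀ {y} → y < 2 ^ w → (M′ [ x + 2 ^ w ↦ v ]) y ≡ M₀ y
      lower≡′ {y} y< = trans (update-other M′ (x + 2 ^ w) λ { refl → ≤⇒≯ (m≤n+m (2 ^ w) x) y< }) (lower≡ S y<)
      upper≡′ : ∀ {y} → y < 2 ^ w → (M′ [ x + 2 ^ w ↦ v ]) (y + 2 ^ w) ≡ (M [ x ↦ v ]) y
      upper≡′ {y} y< with y ≟ x
      ... | yes refl = trans (update-same M′ (x + 2 ^ w) refl) (sym (update-same M x refl))
      ... | no y≢x   = trans (update-other M′ (x + 2 ^ w) (λ eq → y≢x (+-cancelʳ-≡ (2 ^ w) y x eq)))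
                         (trans (upper≡ S y<) (sym (update-other M x y≢x)))
      mem<′ : ∀ y → (M [ x ↦ v ]) y < 2 ^ w
      mem<′ y with y ≡ᵇ x
      ... | true  = v<
      ... | false = mem< S y

    scratch : ∀ {b R M R′ M′ z} → Simulates w n k M₀ b R M R′ M′ → Simulates w n k M₀ b R M (R′ [ 8 ↦ z ]) M′
    scratch S = simulates (own S) (reg≡ S) (reg< S) (lower≡ S) (upper≡ S) (mem< S)

    Result : ℕ → State → State → Set
    Result b (state l R M) (state l′ R′ M′) = l′ ≡ target l × Simulates w n k M₀ b R M R′ M′

    private
      wrapped-address : ∀ {x} → x < 2 ^ w → wrap (suc w) (x + 2 ^ w) ≡ x + 2 ^ w
      wrapped-address {x} x< = wrap-< (suc w) (subst (x + 2 ^ w <_) (sym (2^1+w w)) (+-monoˡ-< (2 ^ w) x<))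

    -- The register is set twice, first to a word of 1 + w bits.
    reduce : ∀ {q l b l′ R M R′ M′ r v is} → Suffix q l (arith mod (32 + r) (32 + r) 6 ∷ is) →
             Simulates w n k M₀ b R M R′ M′ → (z : ℕ) → wrap w z ≡ v → suc l ≡ target l′ →
             Reach (suc w) q (state l (R′ [ 32 + r ↦ z ]) M′) 1 (Result b (state l′ (R [ r ↦ v ]) M))
    reduce {l = l} {b} {l′} {R} {M} {R′} {M′} {r} {v} s S z eq l≡ = reach-step (suffix-head s)
      (reach-done (l≡ , set-reg S (subst (_< 2 ^ w) eq (wrap<2^w w z))
        (λ r′ r′≢r → trans (update-other (R′ [ 32 + r ↦ z ]) (32 + r) (λ e → r′≢r (+-cancelˡ-≡ 32 r′ r e)))
                       (update-other R′ (32 + r) (λ e → r′≢r (+-cancelˡ-≡ 32 r′ r e))))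
        (trans (update-same (R′ [ 32 + r ↦ z ]) (32 + r) refl)
          (trans (cong₂ (⟦ mod ⟧ (suc w)) (update-same R′ (32 + r) refl) r6) (trans (mod-power w z) eq)))
        (own S)))
      where
      r6 : R′ 6 ≡ 2 ^ w
      r6 = let (_ , _ , _ , _ , _ , _ , b6 , _) , _ = own S in b6

    translate-exec : ∀ {q l b R M R′ M′} i {is} → fetch p l ≡ i → i ≢ halt →
      Suffix q (3 + target l) (translate i is) → Simulates w n k M₀ b R M R′ M′ →
      Reach (suc w) q (state (3 + target l) R′ M′) 2 (Result b (exec w i (state l R M)))
    translate-exec {q} {l} {b} {R} {M} {R′} {M′} i fl ne s S = go i ne s
      where
      l<m : i ≢ halt → l < length p
      l<m ne = fetch-≢halt p l (λ eq → ne (trans (sym fl) eq))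
      next≡ : i ≢ halt → 5 + target l ≡ target (suc l)
      next≡ ne = cong (λ x → x * 5 + base)
        (trans (cong suc (m≤n⇒m⊓n≡m (<⇒≤ (l<m ne)))) (sym (m≤n⇒m⊓n≡m (l<m ne))))
      r6 : R′ 6 ≡ 2 ^ w
      r6 = let (_ , _ , _ , _ , _ , _ , b6 , _) , _ = own S in b6
      shifted : Reg → ℕ
      shifted r = wrap (suc w) (R′ (32 + r) + R′ 6)
      address : ∀ r → shifted r ≡ R r + 2 ^ w
      address r = trans (cong₂ (λ x y → wrap (suc w) (x + y)) (reg≡ S r) r6) (wrapped-address (reg< S r))
      n≡ : 5 + target l ≡ target (suc l)
      n≡ = next≡ ne
      go : ∀ i {is} → i ≢ halt → Suffix q (3 + target l) (translate i is) →
           Reach (suc w) q (state (3 + target l) R′ M′) 2 (Result b (exec w i (state l R M)))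
      go (const r c) _ s = reach-step (suffix-head s)
        (reduce {l′ = suc l} (suffix-tail s) S (wrap (suc w) c) (wrap-wrap w c) n≡)
      go (arith o x y z) _ s = reach-step (suffix-head s)
        (reduce {l′ = suc l} (suffix-tail s) S (⟦ o ⟧ (suc w) (R′ (32 + y)) (R′ (32 + z)))
          (trans (cong₂ (λ u v → wrap w (⟦ o ⟧ (suc w) u v)) (reg≡ S y) (reg≡ S z)) (op-wrap o w (reg< S y) (reg< S z))) n≡)
      go (load r x) _ s = reach-step (suffix-head s) (reach-step (suffix-head (suffix-tail s))
        (reach-done (n≡ , set-reg (scratch {z = shifted x} S) (mem< S (R x))
          (λ r′ r′≢r → update-other (R′ [ 8 ↦ shifted x ]) (32 + r) (λ e → r′≢r (+-cancelˡ-≡ 32 r′ r e)))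
          (trans (update-same (R′ [ 8 ↦ shifted x ]) (32 + r) refl) (trans (cong M′ (address x)) (upper≡ S (reg< S x))))
          (own S))))
      go (store x y) _ s = reach-step (suffix-head s) (reach-step (suffix-head (suffix-tail s))
        (reach-done (n≡ , subst₂ (λ u v → Simulates w n k M₀ b R (M [ R x ↦ R y ]) (R′ [ 8 ↦ shifted x ]) (M′ [ u ↦ v ]))
          (sym (address x)) (sym (reg≡ S y)) (scratch (set-mem S (reg< S x) (reg< S y))))))
      go (jump l′) _ s = reach-step (suffix-head s) (reach-done (refl , S))
      go (jlt x y l′) _ s = reach-step (suffix-head s)
        (subst₂ (λ u v → Reach (suc w) q (state (if u <ᵇ v then target l′ else 4 + target l) R′ M′) 1
                           (Result b (state (if R x <ᵇ R y then l′ else suc l) R M)))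
          (sym (reg≡ S x)) (sym (reg≡ S y)) branch)
        where
        branch : Reach (suc w) q (state (if R x <ᵇ R y then target l′ else 4 + target l) R′ M′) 1
                   (Result b (state (if R x <ᵇ R y then l′ else suc l) R M))
        branch with R x <ᵇ R y
        ... | true  = reach-done (refl , S)
        ... | false = reach-step (suffix-head (suffix-tail s)) (reach-done (n≡ , scratch S))
      go halt ne _ = contradiction refl ne

    -- Giving up yields `b ≤ t`, where `t` is a time at which the simulated program has halted: this
    -- is what pays for the fallback.
    Outcome : ℕ → ℕ → State → State → Set
    Outcome t b σ (state l R′ M′) =
      (l ≡ e × ∃ λ b′ → Simulates w n k M₀ b′ (State.reg (run w p t σ)) (State.mem (run w p t σ)) R′ M′) ⊎
      (l ≡ ab × b ≤ t × Base n k (2 ^ w) R′ × ∀ {x} → x < 2 ^ w → M′ x ≡ M₀ x)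

    private
      block-at : ∀ {q} → Suffix q base (blocks base (p ++ halt ∷ [])) →
                 ∀ l → ∃ λ is → Suffix q (target l) (block (target l) (fetch p l) is)
      block-at {q} code l =
        let is , s = suffix-block base (p ++ halt ∷ []) (l ⊓ length p)
                       (subst (l ⊓ length p <_) (sym (length-∷ʳ p halt)) (s≤s (m⊓n≤n l (length p)))) code
        in is , subst (λ i → Suffix q (target l) (block (target l) i is)) (fetch-halt p l) s

      give-up : ∀ {q l i is t σ R M R′ M′} → Suffix q l (block l i is) → Simulates w n k M₀ 0 R M R′ M′ →
                Reach (suc w) q (state l R′ M′) 2 (Outcome t 0 σ)
      give-up {q} {l} {t = t} {σ} {R′ = R′} {M′} s S = reach-step (suffix-head s)
        (subst₂ (λ u v → Reach (suc w) q (state (if u <ᵇ v then 2 + l else 1 + l) R′ M′) 1 (Outcome t 0 σ))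
          (sym (proj₁ (proj₁ (own S)))) (sym (proj₂ (own S)))
          (reach-step (suffix-head (suffix-tail s)) (reach-done (inj₂ (refl , z≤n , proj₁ (own S) , lower≡ S)))))

      continue : ∀ {q l b i is t R M R′ M′} {Q : State → Set} → suc b < 2 ^ suc w →
                 Suffix q l (block l i is) → Simulates w n k M₀ (suc b) R M R′ M′ →
                 (∀ {R″} → Simulates w n k M₀ b R M R″ M′ → Suffix q (3 + l) (translate i is) →
                   Reach (suc w) q (state (3 + l) R″ M′) t Q) →
                 Reach (suc w) q (state l R′ M′) (2 + t) Q
      continue {q} {l} {b} {t = t} {R′ = R′} {M′} {Q} b<W s S K = reach-step (suffix-head s)
        (subst₂ (λ u v → Reach (suc w) q (state (if u <ᵇ v then 2 + l else 1 + l) R′ M′) (1 + t) Q)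
          (sym (proj₁ (proj₁ (own S)))) (sym (proj₂ (own S)))
          (reach-step (suffix-head (suffix-tail (suffix-tail s)))
            (K (simulates (proj₁ (own S) , trans (cong₂ (⟦ sub ⟧ (suc w)) (proj₂ (own S)) r1) (sub-1 {suc w} b<W))
                 (reg≡ S) (reg< S) (lower≡ S) (upper≡ S) (mem< S))
               (suffix-tail (suffix-tail (suffix-tail s))))))
        where
        r1 : R′ 1 ≡ 1
        r1 = proj₁ (proj₂ (proj₁ (own S)))

      halt? : ∀ i → i ≡ halt ⊎ i ≢ halt
      halt? (const _ _)     = inj₂ λ ()
      halt? (arith _ _ _ _) = inj₂ λ ()
      halt? (load _ _)      = inj₂ λ ()
      halt? (store _ _)     = inj₂ λ ()
      halt? (jump _)        = inj₂ λ ()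
      halt? (jlt _ _ _)     = inj₂ λ ()
      halt? halt            = inj₁ refl

    -- The loop ends at a halt or when the budget is used up, whichever is earlier, whence `t ⊓ b`.
    -- A program that halts before time `t` is still in the same state at time `t`.
    simulation : ∀ {q} → Suffix q base (blocks base (p ++ halt ∷ [])) →
      ∀ t b l {R M R′ M′} → b < 2 ^ suc w → Simulates w n k M₀ b R M R′ M′ →
      Halted p (run w p t (state l R M)) →
      Reach (suc w) q (state (target l) R′ M′) ((t ⊓ b) * 5 + 5) (Outcome t b (state l R M))
    simulation {q} code t zero l b<W S h =
      reach-mono (≤-trans (s≤s (s≤s z≤n)) (m≤n+m 5 ((t ⊓ 0) * 5))) (λ o → o) (give-up {t = t} (proj₂ (block-at code l)) S)
    simulation {q} code t (suc b) l {R} {M} {R′} {M′} b<W S h with halt? (fetch p l)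
    ... | inj₁ eq = reach-mono (≤-trans (s≤s (s≤s (s≤s z≤n))) (m≤n+m 5 ((t ⊓ suc b) * 5))) (λ o → o)
      (continue {i = halt} b<W (subst (λ i → Suffix q (target l) (block (target l) i (proj₁ (block-at code l)))) eq (proj₂ (block-at code l))) S
        λ S′ s → reach-step (suffix-head s) (reach-done {t = 0}
          (inj₁ (refl , b , subst (λ σ → Simulates w n k M₀ b (State.reg σ) (State.mem σ) _ M′)
            (sym (halted-stays w p t (state l R M) eq)) S′))))
    simulation {q} code zero (suc b) l b<W S h | inj₂ ne = contradiction h ne
    simulation {q} code (suc t) (suc b) l {R} {M} b<W S h | inj₂ ne =
      continue b<W (proj₂ (block-at code l)) S λ S′ s →
        reach-bind (translate-exec (fetch p l) refl ne s S′) resume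
      where
      resume : ∀ σ′ → Result b (exec w (fetch p l) (state l R M)) σ′ →
               Reach (suc w) q σ′ (1 + ((t ⊓ b) * 5 + 5)) (Outcome (suc t) (suc b) (state l R M))
      resume (state _ _ _) (refl , S) =
        -- Two steps for the budget and at most two for the instruction leave one of the five
        -- charged steps to spare.
        reach-mono (n≤1+n _) (λ { (inj₁ r) → inj₁ r ; (inj₂ (eq , b≤t , r)) → inj₂ (eq , s≤s b≤t , r) })
          (simulation code t b _ (<-trans ≤-refl b<W) S h)

-- Preparing the simulation

contents-++ˡ : ∀ xs ys {i} → i < length xs → contents (xs ++ ys) i ≡ contents xs i
contents-++ˡ (x ∷ xs) ys {zero}  _         = refl
contents-++ˡ (x ∷ xs) ys {suc i} (s≤s i<)  = contents-++ˡ xs ys i<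

contents-++ʳ : ∀ xs ys i → contents (xs ++ ys) (length xs + i) ≡ contents ys i
contents-++ʳ []       ys i = refl
contents-++ʳ (x ∷ xs) ys i = contents-++ʳ xs ys i

contents-beyond : ∀ xs {i} → length xs ≤ i → contents xs i ≡ 0
contents-beyond []       _        = refl
contents-beyond (x ∷ xs) (s≤s le) = contents-beyond xs le

-- On words of `1 + w` bits `0 - 1` is `2 ^ suc w ∸ 1`; halving it and adding 1 puts `2 ^ w` into
-- register 6. The matrix is copied twice, once for each factor of its square.
setup copyEntry copy : Cmd
setup =
  prim (const 1 1) ⨾ prim (load 2 0) ⨾ prim (load 3 1) ⨾ prim (arith mul 4 2 2) ⨾
  prim (const 13 2) ⨾ prim (arith add 22 4 13) ⨾ prim (arith add 5 22 1) ⨾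
  prim (arith sub 13 0 1) ⨾ prim (const 14 2) ⨾ prim (arith div 13 13 14) ⨾ prim (arith add 6 13 1) ⨾ skip
copyEntry =
  prim (arith add 16 13 10) ⨾ prim (load 16 16) ⨾ prim (arith add 17 14 10) ⨾ prim (store 17 16) ⨾
  prim (arith add 17 15 10) ⨾ prim (store 17 16) ⨾ skip
copy =
  prim (arith mul 7 3 4) ⨾ prim (store 6 2) ⨾ prim (arith add 14 6 1) ⨾ prim (arith add 15 14 4) ⨾
  prim (const 13 2) ⨾
  for 10 4 copyEntry

half-max : ∀ w → ⟦ div ⟧ (suc w) (2 ^ suc w ∸ 1) 2 ≡ 2 ^ w ∸ 1
half-max w = trans (wrap-< (suc w) (subst (_< 2 ^ suc w) (sym half) (≤-<-trans (m∸n≤m (2 ^ w) 1) (2^w<2^1+w w)))) half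
  where
  odd : ∀ m → 0 < m → (m + m ∸ 1) / 2 ≡ m ∸ 1
  odd (suc m) _ = begin
    (m + suc m) / 2         ≡⟨ cong (_/ 2) (+-suc m m) ⟩
    (1 + (m + m)) / 2       ≡⟨ cong (λ x → (1 + x) / 2) (trans (cong (m +_) (sym (+-identityʳ m))) (*-comm 2 m)) ⟩
    (1 + m * 2) / 2         ≡⟨ +-distrib-/-∣ʳ 1 {m * 2} {2} (divides-refl m) ⟩
    m * 2 / 2               ≡⟨ m*n/n≡m m 2 ⟩
    m                       ∎
    where open ≡-Reasoning
  half : (2 ^ suc w ∸ 1) / 2 ≡ 2 ^ w ∸ 1
  half = trans (cong (λ x → (x ∸ 1) / 2) (2^1+w w)) (odd (2 ^ w) (m^n>0 2 w))

setup-exec : ∀ {w n k xs Q} → n * n + 3 ≤ 2 ^ w →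
  (∀ {R} → Base n k (2 ^ w) R → (∀ r → R (32 + r) ≡ 0) → Q R (contents (n ∷ k ∷ xs))) →
  Exec (suc w) setup (λ _ → 0) (contents (n ∷ k ∷ xs)) 11 Q
setup-exec {w} {n} {k} {xs} {Q} fits K =
  const! (small (s≤s z≤n))
  (load! refl refl (load! refl refl
  (mul! refl refl (small′ (≤-trans (m≤m+n (n * n) 3) fits))
  (const! (small (s≤s (s≤s z≤n)))
  (add! refl refl (small′ (≤-trans (+-monoʳ-≤ (n * n) (s≤s (s≤s z≤n))) fits))
  (arith! refl refl (trans (wrap-< (suc w) (small′ (≤-trans (≤-reflexive (+-assoc (n * n) 2 1)) fits))) (+-assoc (n * n) 2 1))
  (arith! refl refl (wrap-< (suc w) (∸-monoʳ-< {2 ^ suc w} {1} {0} (s≤s z≤n) (m^n>0 2 (suc w))))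
  (const! (small (s≤s (s≤s z≤n)))
  (arith! refl refl (half-max w)
  (arith! refl refl (trans (cong (wrap (suc w)) P-1+1) (wrap-< (suc w) (2^w<2^1+w w)))
  (done (K (refl , refl , refl , refl , refl , refl , refl , refl) (λ r → refl)))))))))))))
  where
  small′ : ∀ {x} → x ≤ 2 ^ w → x < 2 ^ suc w
  small′ le = ≤-<-trans le (2^w<2^1+w w)
  small : ∀ {x} → x ≤ 3 → x < 2 ^ suc w
  small le = small′ (≤-trans (≤-trans le (m≤n+m 3 (n * n))) fits)
  P-1+1 : 2 ^ w ∸ 1 + 1 ≡ 2 ^ w
  P-1+1 = m∸n+n≡m (m^n>0 2 w)

-- The real input ends within the lower half, so the upper half is blank outside the cells copied,
-- as an initial memory of the simulated machine has to be.
copy-exec : ∀ {w n k xs R Q} → length xs ≡ n * n → n * n + 3 ≤ 2 ^ w → 1 + n * n + n * n ≤ 2 ^ w →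
  k * (n * n) < 2 ^ suc w →
  Base n k (2 ^ w) R → (∀ r → R (32 + r) ≡ 0) →
  (∀ x → 2 ^ w ≤ x → contents (n ∷ k ∷ xs) x ≡ 0) →
  (∀ {R′ M′} → Base n k (2 ^ w) R′ → R′ 7 ≡ k * (n * n) → (∀ r → R′ (32 + r) ≡ 0) →
    (∀ {x} → x < 2 ^ w → M′ x ≡ contents (n ∷ k ∷ xs) x) →
    (∀ {x} → x < 2 ^ w → M′ (x + 2 ^ w) ≡ contents (n ∷ xs ++ xs) x) → Q R′ M′) →
  Exec (suc w) copy R (contents (n ∷ k ∷ xs)) (5 + (n * n * (6 + 3) + 3)) Q
copy-exec {w} {n} {k} {xs} {R₀} {Q} len fits fits′ budget base₀@(c0 , c1 , c2 , c3 , c4 , c5 , c6 , _) z₀ blank K =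
  mul! c3 c4 budget
  (store! c6 c2
  (add! c6 c1 (upper-word 1 (≤-trans (s≤s (s≤s z≤n)) (≤-trans (m≤n+m 3 nn) fits)))
  (add! refl c4 (subst (_< 2 ^ suc w) (sym (+-assoc P 1 nn)) (upper-word (1 + nn) (≤-trans (≤-trans (≤-reflexive (+-comm 2 nn)) (+-monoʳ-≤ nn (s≤s (s≤s z≤n)))) fits)))
  (const! (≤-<-trans (≤-trans (≤-trans (s≤s (s≤s z≤n)) (m≤n+m 3 nn)) fits) (2^w<2^1+w w))
    (for! nn 6 I (≤-<-trans (≤-trans (m≤m+n nn 3) fits) (2^w<2^1+w w))
      (λ ((_ , b1 , _ , _ , b4 , _) , _ , _ , r10 , _) → b1 , b4 , r10)
      (base₀ , refl , z₀ , refl , refl , refl , refl ,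
        (λ x<P → update-other M₀ P (<⇒≢ x<P)) , update-same M₀ P refl ,
        (λ ()) ,
        λ {x} 1+2nn≤x → trans (update-other M₀ P λ eq → <⇒≢ (≤-trans (s≤s z≤n) 1+2nn≤x) (sym (m+n≡n⇒m≡0 eq))) (blank (x + P) (m≤n+m P x)))
      (λ j j<nn i → body j<nn i)
      λ {_} {M′} (base , r7 , z , _ , _ , _ , _ , lower , first , copied , rest) →
        K base r7 z lower (upper {M′} first copied rest))))))
  where
  P nn : ℕ
  P  = 2 ^ w
  nn = n * n
  M₀ : Mem
  M₀ = contents (n ∷ k ∷ xs)

  m+n≡n⇒m≡0 : ∀ {m} → m + P ≡ P → m ≡ 0
  m+n≡n⇒m≡0 {m} eq = +-cancelʳ-≡ P m 0 eq

  upper-word : ∀ x → x < P → P + x < 2 ^ suc w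
  upper-word x x<P = subst (P + x <_) (sym (2^1+w w)) (+-monoʳ-< P x<P)

  I : ℕ → Regs → Mem → Set
  I j R M = Base n k P R × R 7 ≡ k * nn × (∀ r → R (32 + r) ≡ 0) × R 10 ≡ j × R 13 ≡ 2 ×
    R 14 ≡ P + 1 × R 15 ≡ P + 1 + nn × (∀ {x} → x < P → M x ≡ M₀ x) × M P ≡ n ×
    (∀ {i} → i < j → M (suc i + P) ≡ contents xs i × M (suc (nn + i) + P) ≡ contents xs i) ×
    (∀ {x} → 1 + nn + nn ≤ x → M (x + P) ≡ 0)

  body : ∀ {j R M} → j < nn → I j R M →
    Exec (suc w) copyEntry R M 6 (λ R′ M′ → (R′ 1 ≡ 1 × R′ 10 ≡ j) × I (suc j) (R′ [ 10 ↦ suc j ]) M′)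
  body {j} {R} {M} j<nn (base@(_ , b1 , _) , r7 , z , r10 , r13 , r14 , r15 , lower , first , copied , rest) =
    add! r13 r10 (≤-<-trans (≤-trans (s≤s (≤-trans j<nn (m≤m+n nn nn))) fits′) (2^w<2^1+w w))
    (load! refl (lower (≤-trans (s≤s (s≤s j<nn)) (≤-trans (≤-reflexive (+-comm 2 nn)) (≤-trans (+-monoʳ-≤ nn (s≤s (s≤s z≤n))) fits))))
    (arith! r14 r10 (trans (wrap-< (suc w) (subst (_< 2 ^ suc w) (sym (+-assoc P 1 j)) (upper-word (suc j) j₁<P)))
                           (trans (+-assoc P 1 j) (+-comm P (suc j))))
    (store! refl refl
    (arith! r15 r10 (trans (wrap-< (suc w) (subst (_< 2 ^ suc w) (sym eq₂) (upper-word (suc (nn + j)) j₂<P)))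
                           (trans eq₂ (+-comm P (suc (nn + j)))))
    (store! refl refl
    (done ((b1 , r10) , base , r7 , z , refl , r13 , r14 , r15 ,
      (λ {x} x<P → trans (update-other M₁ _ (low x<P)) (trans (update-other M _ (low x<P)) (lower x<P))) ,
      trans (untouched {0} (λ ()) (λ ())) first ,
      copied′ ,
      λ {x} le → trans (untouched {x} (λ { refl → ≤⇒≯ le (s≤s (<-≤-trans j<nn (m≤m+n nn nn))) }) (λ { refl → ≤⇒≯ le (s≤s (+-monoʳ-< nn j<nn)) })) (rest le))))))))
    where
    eq₂ : P + 1 + nn + j ≡ P + suc (nn + j)
    eq₂ = trans (+-assoc (P + 1) nn j) (+-assoc P 1 (nn + j))
    j₁<P : suc j < P
    j₁<P = ≤-trans (s≤s (≤-trans j<nn (m≤m+n nn nn))) fits′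
    j₂<P : suc (nn + j) < P
    j₂<P = ≤-trans (s≤s (+-monoʳ-< nn j<nn)) fits′
    v : ℕ
    v = contents xs j
    M₁ M₂ : Mem
    M₁ = M [ suc j + P ↦ v ]
    M₂ = M₁ [ suc (nn + j) + P ↦ v ]
    low : ∀ {x y} → x < P → x ≢ y + P
    low {y = y} x<P refl = ≤⇒≯ (m≤n+m P y) x<P
    untouched : ∀ {x} → x ≢ suc j → x ≢ suc (nn + j) → M₂ (x + P) ≡ M (x + P)
    untouched {x} ne₁ ne₂ = trans (update-other M₁ _ λ eq → ne₂ (+-cancelʳ-≡ P x _ eq))
                                  (update-other M _ λ eq → ne₁ (+-cancelʳ-≡ P x _ eq))
    copied′ : ∀ {i} → i < suc j → M₂ (suc i + P) ≡ contents xs i × M₂ (suc (nn + i) + P) ≡ contents xs i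
    copied′ {i} i<1+j with m≤n⇒m<n∨m≡n (≤-pred i<1+j)
    ... | inj₁ i<j =
      trans (untouched {suc i} (λ eq → <⇒≢ i<j (suc-injective eq))
              (λ eq → <⇒≢ (<-≤-trans (<-trans i<j j<nn) (m≤m+n nn j)) (suc-injective eq))) (proj₁ (copied i<j)) ,
      trans (untouched {suc (nn + i)} (λ eq → <⇒≢ (<-≤-trans j<nn (m≤m+n nn i)) (sym (suc-injective eq)))
              (λ eq → <⇒≢ i<j (+-cancelˡ-≡ nn i j (suc-injective eq)))) (proj₂ (copied i<j))
    ... | inj₂ refl =
      trans (update-other M₁ _ λ eq → <⇒≢ (<-≤-trans j<nn (m≤m+n nn j)) (suc-injective (+-cancelʳ-≡ P (suc j) (suc (nn + j)) eq)))
            (update-same M (suc j + P) refl) ,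
      update-same M₁ (suc (nn + j) + P) refl

  upper : ∀ {M} → M P ≡ n → (∀ {i} → i < nn → M (suc i + P) ≡ contents xs i × M (suc (nn + i) + P) ≡ contents xs i) →
    (∀ {x} → 1 + nn + nn ≤ x → M (x + P) ≡ 0) → ∀ {x} → x < P → M (x + P) ≡ contents (n ∷ xs ++ xs) x
  upper first copied rest {zero} _ = first
  upper {M} first copied rest {suc y} _ with <-≤-connex y nn
  ... | inj₁ y<nn = trans (proj₁ (copied y<nn)) (sym (contents-++ˡ xs xs (subst (y <_) (sym len) y<nn)))
  ... | inj₂ nn≤y with m≤n⇒∃[o]m+o≡n nn≤y
  ... | i , refl with <-≤-connex i nn
  ... | inj₁ i<nn = trans (proj₂ (copied i<nn))
    (sym (subst (λ m → contents (xs ++ xs) (m + i) ≡ contents xs i) len (contents-++ʳ xs xs i)))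
  ... | inj₂ nn≤i = trans (rest (s≤s (+-monoʳ-≤ nn nn≤i)))
    (sym (trans (subst (λ m → contents (xs ++ xs) (m + i) ≡ contents xs i) len (contents-++ʳ xs xs i))
           (contents-beyond xs (subst (_≤ i) (sym len) nn≤i))))

-- Matrices, tournaments and outputs in memory

contents-tabulate : ∀ {m} (f : Fin m → ℕ) i → contents (tabulate f) (toℕ i) ≡ f i
contents-tabulate f zero    = refl
contents-tabulate f (suc i) = contents-tabulate (λ j → f (suc j)) i

contents-lookup : ∀ xs (i : Fin (length xs)) → lookup xs i ≡ contents xs (toℕ i)
contents-lookup (x ∷ xs) zero    = refl
contents-lookup (x ∷ xs) (suc i) = contents-lookup xs i

length-rowMajor : ∀ {n} (A : Matrix n) → length (rowMajor A) ≡ n * n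
length-rowMajor A = length-tabulate (Vector.concat A)

contents-rowMajor : ∀ {n} (A : Matrix n) i j → contents (rowMajor A) (toℕ i * n + toℕ j) ≡ A i j
contents-rowMajor {n} A i j = begin
  contents (rowMajor A) (toℕ i * n + toℕ j)   ≡⟨ cong (λ x → contents (rowMajor A) (x + toℕ j)) (*-comm (toℕ i) n) ⟩
  contents (rowMajor A) (n * toℕ i + toℕ j)   ≡⟨ cong (contents (rowMajor A)) (toℕ-combine i j) ⟨
  contents (rowMajor A) (toℕ (combine i j))   ≡⟨ contents-tabulate (Vector.concat A) (combine i j) ⟩
  Vector.concat A (combine i j)               ≡⟨ cong (λ (r , q) → A q r) (cong swap (remQuot-combine i j)) ⟩
  A i j                                       ∎
  where open ≡-Reasoning

length-rowMajor² : ∀ {n} (A B : Matrix n) → length (rowMajor A ++ rowMajor B) ≡ n * n + n * n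
length-rowMajor² A B = trans (length-++ (rowMajor A)) (cong₂ _+_ (length-rowMajor A) (length-rowMajor B))

all-rowMajor : ∀ {n} {P : ℕ → Set} (A : Matrix n) → (∀ i j → P (A i j)) → All P (rowMajor A)
all-rowMajor {n} A h = tabulate⁺ λ x → h (proj₂ (quotRem {n} n x)) (proj₁ (quotRem {n} n x))

foldr-≤ : ∀ {m} (f : Fin m → ℕ) → (∀ i → f i ≤ 1) → Vector.foldr _+_ 0 f ≤ m
foldr-≤ {zero}  f h = z≤n
foldr-≤ {suc m} f h = +-mono-≤ (h zero) (foldr-≤ (λ i → f (suc i)) λ i → h (suc i))

foldr-positive : ∀ {m} (f : Fin m → ℕ) i → 0 < f i → 0 < Vector.foldr _+_ 0 f
foldr-positive f zero    pos = <-≤-trans pos (m≤m+n _ _)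
foldr-positive f (suc i) pos = <-≤-trans (foldr-positive (λ j → f (suc j)) i pos) (m≤n+m _ (f zero))

foldr-positive⁻¹ : ∀ {m} (f : Fin m → ℕ) → 0 < Vector.foldr _+_ 0 f → ∃ λ i → 0 < f i
foldr-positive⁻¹ {suc m} f pos with f zero in eq
... | suc x = zero , subst (0 <_) (sym eq) (s≤s z≤n)
... | zero  = let i , pos′ = foldr-positive⁻¹ (λ j → f (suc j)) pos in suc i , pos′

-- This makes the entries of the product words, as the multiplication program demands.
⊗-≤ : ∀ {n} (A B : Matrix n) → (∀ i j → A i j ≤ 1) → (∀ i j → B i j ≤ 1) → ∀ i l → (A ⊗ B) i l ≤ n
⊗-≤ A B hA hB i l = foldr-≤ (λ j → A i j * B j l) λ j → *-mono-≤ (hA i j) (hB j l)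

-- A step writes at most one cell, so computing a list without zeros takes at
-- least as many steps as its length.
written : Mem → ℕ → ℕ → ℕ
written M b m = ∑ m (λ i → 1 ⊓ M (b + i))

written-store : ∀ M b m a v → written (M [ a ↦ v ]) b m ≤ 1 + written M b m
written-store M b m a v = begin
  ∑ m (λ i → 1 ⊓ (M [ a ↦ v ]) (b + i))                 ≤⟨ ∑-mono m (λ i _ → cell i) ⟩
  ∑ m (λ i → onDiagonal 1 (a ∸ b) i + 1 ⊓ M (b + i))    ≡⟨ ∑-+ m (onDiagonal 1 (a ∸ b)) (λ i → 1 ⊓ M (b + i)) ⟩
  ∑ m (onDiagonal 1 (a ∸ b)) + written M b m            ≤⟨ +-monoˡ-≤ _ (∑-onDiagonal m 1 (a ∸ b)) ⟩
  1 + written M b m                                     ∎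
  where
  open ≤-Reasoning
  cell : ∀ i → 1 ⊓ (M [ a ↦ v ]) (b + i) ≤ onDiagonal 1 (a ∸ b) i + 1 ⊓ M (b + i)
  cell i with b + i ≟ a
  ... | no ne = ≤-trans (≤-reflexive (cong (1 ⊓_) (update-other M a ne))) (m≤n+m _ (onDiagonal 1 (a ∸ b) i))
  ... | yes refl = ≤-trans (m⊓n≤m 1 _)
    (≤-trans (≤-reflexive (sym (onDiagonal-≡ 1 (m+n∸m≡n b i)))) (m≤m+n _ _))

written-exec : ∀ w i σ b m → written (State.mem (exec w i σ)) b m ≤ 1 + written (State.mem σ) b m
written-exec w (const r c)     σ b m = n≤1+n _
written-exec w (arith o r s t) σ b m = n≤1+n _
written-exec w (load r s)      σ b m = n≤1+n _
written-exec w (store r s)     σ b m = written-store (State.mem σ) b m _ _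
written-exec w (jump l)        σ b m = n≤1+n _
written-exec w (jlt r s l)     σ b m = n≤1+n _
written-exec w halt            σ b m = n≤1+n _

written-run : ∀ w p t σ b m → written (State.mem (run w p t σ)) b m ≤ t + written (State.mem σ) b m
written-run w p zero    σ b m = ≤-refl
written-run w p (suc t) σ b m = ≤-trans (written-run w p t _ b m)
  (≤-trans (+-monoʳ-≤ t (written-exec w (fetch p (State.pc σ)) σ b m)) (≤-reflexive (+-suc t _)))

output-length-≤ : ∀ {w p xs t} ys → ComputesWithin w p xs ys t →
                  (∀ i → 1 ≤ lookup ys i) → length ys ≤ t
output-length-≤ {w} {p} {xs} {t} ys (_ , output) pos = begin
  length ys                                  ≡⟨ trans (∑-const (length ys) 1) (*-identityʳ _) ⟨
  ∑ (length ys) (λ _ → 1)                    ≤⟨ ∑-mono (length ys) nonzero ⟩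
  written (State.mem (run w p t (initial xs))) (length xs) (length ys)
                                             ≤⟨ written-run w p t (initial xs) (length xs) (length ys) ⟩
  t + written (contents xs) (length xs) (length ys)
    ≤⟨ +-monoʳ-≤ t (∑-mono (length ys) λ i _ → ≤-trans (m⊓n≤n 1 _) (≤-reflexive (contents-beyond xs (m≤m+n (length xs) i)))) ⟩
  t + ∑ (length ys) (λ _ → 0)                ≡⟨ cong (t +_) (trans (∑-const (length ys) 0) (*-zeroʳ (length ys))) ⟩
  t + 0                                      ≡⟨ +-identityʳ t ⟩
  t                                          ∎
  where
  open ≤-Reasoning
  nonzero : ∀ i → i < length ys → 1 ≤ 1 ⊓ State.mem (run w p t (initial xs)) (length xs + i)
  nonzero i i< = ⊓-glb ≤-refl (subst (1 ≤_) eq (pos (fromℕ< i<)))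
    where
    eq : lookup ys (fromℕ< i<) ≡ State.mem (run w p t (initial xs)) (length xs + i)
    eq = trans (sym (output (fromℕ< i<))) (cong (λ x → State.mem (run w p t (initial xs)) (length xs + x)) (toℕ-fromℕ< i<))

onesMatrix : ∀ n → Matrix n
onesMatrix n _ _ = 1

-- The program is correct for all-ones matrices, whose product has no zeros.
multiplication-≥n² : ∀ {w p c t n} → 1 ≤ n →
  (∀ (x : MatrixPair) → MatrixPair.n x ≡ n → length (Problem.input matrixMultiplication x) ^ c ≤ 2 ^ w →
     Problem.Fits matrixMultiplication w x →
     ∃ λ ys → Problem.Output matrixMultiplication x ys × ComputesWithin w p (Problem.input matrixMultiplication x) ys t) →
  (1 + (n * n + n * n)) ^ c ≤ 2 ^ w → n < 2 ^ w → n * n ≤ t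
multiplication-≥n² {w} {p} {c} {t} {n} 1≤n solves large n<W
  with solves (record { n = n ; 1≤n = 1≤n ; A = onesMatrix n ; B = onesMatrix n }) refl
         (subst (λ l → suc l ^ c ≤ 2 ^ w) (sym (length-rowMajor² (onesMatrix n) (onesMatrix n))) large)
         (n<W ∷ ++⁺ ones<W ones<W ,
          all-rowMajor (onesMatrix n ⊗ onesMatrix n) λ i j →
            ≤-<-trans (⊗-≤ (onesMatrix n) (onesMatrix n) (λ _ _ → ≤-refl) (λ _ _ → ≤-refl) i j) n<W)
  where
  ones<W : All (_< 2 ^ w) (rowMajor (onesMatrix n))
  ones<W = all-rowMajor (onesMatrix n) λ _ _ → ≤-<-trans 1≤n n<W
... | _ , refl , computes =
  subst (_≤ t) (length-rowMajor (onesMatrix n ⊗ onesMatrix n)) (output-length-≤ (rowMajor (onesMatrix n ⊗ onesMatrix n)) computes λ i → All.lookup positive (∈-lookup i))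
  where
  positive : All (1 ≤_) (rowMajor (onesMatrix n ⊗ onesMatrix n))
  positive = all-rowMajor (onesMatrix n ⊗ onesMatrix n) λ i _ → foldr-positive (λ _ → 1) i ≤-refl

-- Matching the equation with `refl` turns a bounded number into `toℕ` of a vertex.
fin : ∀ {n u} → u < n → ∃ λ (i : Fin n) → toℕ i ≡ u
fin u<n = fromℕ< u<n , toℕ-fromℕ< u<n

-- Tournaments and their kings in terms of arrays

module _ {n : ℕ} (T : Tournament n) where
  open Tournament T

  arcs paths : ℕ → ℕ → ℕ
  arcs  u v = contents (rowMajor (adjacency T)) (u * n + v)
  paths u v = contents (rowMajor (adjacency T ⊗ adjacency T)) (u * n + v)

  adjacency≤1 : ∀ i j → adjacency T i j ≤ 1
  adjacency≤1 i j with edge i j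
  ... | true  = ≤-refl
  ... | false = z≤n

  edge⇒arc : ∀ {i j} → edge i j ≡ true → arcs (toℕ i) (toℕ j) ≡ 1
  edge⇒arc {i} {j} e = trans (contents-rowMajor (adjacency T) i j) (cong (if_then 1 else 0) e)

  ¬edge⇒¬arc : ∀ {i j} → edge i j ≡ false → arcs (toℕ i) (toℕ j) ≡ 0
  ¬edge⇒¬arc {i} {j} e = trans (contents-rowMajor (adjacency T) i j) (cong (if_then 1 else 0) e)

  arc⇒edge : ∀ {i j} → arcs (toℕ i) (toℕ j) ≡ 1 → edge i j ≡ true
  arc⇒edge {i} {j} eq with edge i j in e
  ... | true  = refl
  ... | false = contradiction (trans (sym eq) (¬edge⇒¬arc e)) λ ()

  arcs-tournament : IsTournament n arcs
  arcs-tournament = record { irrefl = irrefl′ ; arc = arc′ }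
    where
    irrefl′ : ∀ {u} → u < n → arcs u u ≡ 0
    irrefl′ u<n with fin u<n
    ... | i , refl = ¬edge⇒¬arc (loopless i)
    arc′ : ∀ {u v} → u < n → v < n → u ≢ v → (arcs u v ≡ 1 × arcs v u ≡ 0) ⊎ (arcs u v ≡ 0 × arcs v u ≡ 1)
    arc′ u<n v<n u≢v with fin u<n | fin v<n
    ... | i , refl | j , refl with edge i j in e₁ | edge j i in e₂ | oneEdge i j (λ { refl → u≢v refl })
    ... | true  | false | _ = inj₁ (edge⇒arc e₁ , ¬edge⇒¬arc e₂)
    ... | false | true  | _ = inj₂ (¬edge⇒¬arc e₁ , edge⇒arc e₂)

  paths-product : ∀ {u v} → u < n → v < n →
    (0 < paths u v → ∃ λ x → x < n × arcs u x ≡ 1 × arcs x v ≡ 1) ×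
    ((∃ λ x → x < n × arcs u x ≡ 1 × arcs x v ≡ 1) → 0 < paths u v)
  paths-product u<n v<n with fin u<n | fin v<n
  ... | i , refl | l , refl = to , from
    where
    entry : paths (toℕ i) (toℕ l) ≡ (adjacency T ⊗ adjacency T) i l
    entry = contents-rowMajor (adjacency T ⊗ adjacency T) i l
    to : 0 < paths (toℕ i) (toℕ l) → ∃ λ x → x < n × arcs (toℕ i) x ≡ 1 × arcs x (toℕ l) ≡ 1
    to pos with foldr-positive⁻¹ (λ j → adjacency T i j * adjacency T j l) (subst (0 <_) entry pos)
    ... | j , pos′ with edge i j in e₁ | edge j l in e₂
    ... | true | true = toℕ j , toℕ<n j , edge⇒arc e₁ , edge⇒arc e₂
    from : (∃ λ x → x < n × arcs (toℕ i) x ≡ 1 × arcs x (toℕ l) ≡ 1) → 0 < paths (toℕ i) (toℕ l)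
    from (x , x<n , a₁ , a₂) with fin x<n
    ... | j , refl = subst (0 <_) (sym entry)
      (foldr-positive (λ j → adjacency T i j * adjacency T j l) j
        (≤-reflexive (sym (cong₂ (λ a b → (if a then 1 else 0) * (if b then 1 else 0)) (arc⇒edge a₁) (arc⇒edge a₂)))))

  king⇒isKing : ∀ {v} → King n arcs (toℕ v) → IsKing T v
  king⇒isKing {v} king u u≢v with king (toℕ u) (toℕ<n u) (λ eq → u≢v (toℕ-injective eq))
  ... | inj₁ vu = 1 , s≤s z≤n , arc⇒edge vu ∷ stop
  ... | inj₂ (x , x<n , vx , xu) with fin x<n
  ... | j , refl = 2 , ≤-refl , arc⇒edge vx ∷ arc⇒edge xu ∷ stop

  isKing⇒king : ∀ {v} → IsKing T v → King n arcs (toℕ v)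
  isKing⇒king king u u<n u≢v with fin u<n
  ... | i , refl with king i (λ { refl → u≢v refl })
  ... | _ , _ , stop = contradiction refl u≢v
  ... | _ , _ , e ∷ stop = inj₁ (edge⇒arc e)
  ... | _ , _ , _∷_ {v = x} e₁ (e₂ ∷ stop) = inj₂ (toℕ x , toℕ<n x , edge⇒arc e₁ , edge⇒arc e₂)
  ... | _ , s≤s (s≤s ()) , _ ∷ _ ∷ _ ∷ _

  KingsOutput : ℕ → List ℕ → Set
  KingsOutput k ys =
      (∃ λ vs → DistinctKings T k vs × ys ≡ 1 ∷ Vector.toList (Vector.map toℕ vs))
    ⊎ (¬ (∃ λ vs → DistinctKings T k vs) × ys ≡ 0 ∷ [])

  n<k⇒¬distinctKings : ∀ {k} → n < k → ¬ (∃ λ vs → DistinctKings T k vs)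
  n<k⇒¬distinctKings n<k (vs , injective , _) with pigeonhole n<k vs
  ... | i , j , i<j , eq = <⇒≢ i<j (cong toℕ (injective eq))

  -- A full list is the output itself. With `c < k` entries the list contains all kings, so `k`
  -- distinct kings would occupy distinct positions below `c`, against the pigeonhole principle.
  answer⇒output : ∀ {k M} → Answer n arcs k M → ∃ λ ys → KingsOutput k ys × (∀ i → M (n * n + 2 + toℕ i) ≡ lookup ys i)
  answer⇒output {k} {M} (c , F , inj₁ (refl , flag)) =
    1 ∷ Vector.toList (Vector.map toℕ vs) ,
    inj₁ (vs , (injective , λ i → king⇒isKing (subst (King n arcs) (sym (vs≡ i)) (proj₁ (proj₂ (sound F (toℕ<n i)))))) , refl) ,
    at
    where
    vs : Vector (Fin n) k
    vs i = fromℕ< (proj₁ (sound F (toℕ<n i)))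
    vs≡ : ∀ i → toℕ (vs i) ≡ M (n * n + 3 + toℕ i)
    vs≡ i = toℕ-fromℕ< (proj₁ (sound F (toℕ<n i)))
    injective : ∀ {i j} → vs i ≡ vs j → i ≡ j
    injective {i} {j} eq = toℕ-injective (distinct F (toℕ<n i) (toℕ<n j)
      (trans (sym (vs≡ i)) (trans (cong toℕ eq) (vs≡ j))))
    at : ∀ i → M (n * n + 2 + toℕ i) ≡ lookup (1 ∷ Vector.toList (Vector.map toℕ vs)) i
    at zero    = trans (cong M (+-identityʳ (n * n + 2))) flag
    at (suc i) = trans (cell (subst (toℕ i <_) (length-tabulate (Vector.map toℕ vs)) (toℕ<n i)))
                       (sym (contents-lookup (Vector.toList (Vector.map toℕ vs)) i))
      where
      cell : ∀ {x} → x < k → M (n * n + 2 + suc x) ≡ contents (Vector.toList (Vector.map toℕ vs)) x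
      cell {x} x<k with fin x<k
      ... | j , refl = trans (cong M (trans (+-assoc (n * n) 2 (suc (toℕ j))) (sym (+-assoc (n * n) 3 (toℕ j)))))
        (sym (trans (contents-tabulate (Vector.map toℕ vs) j) (vs≡ j)))
  answer⇒output {k} {M} (c , F , inj₂ (c<k , flag)) = 0 ∷ [] , inj₂ (none , refl) ,
    λ { zero → trans (cong M (+-identityʳ (n * n + 2))) flag }
    where
    none : ¬ (∃ λ vs → DistinctKings T k vs)
    none (vs , injective , kings) =
      let i , j , i<j , eq = pigeonhole c<k index
      in <⇒≢ i<j (cong toℕ (injective (toℕ-injective (begin
           toℕ (vs i)                         ≡⟨ position≡ i ⟨
           M (n * n + 3 + toℕ (index i))      ≡⟨ cong (λ x → M (n * n + 3 + toℕ x)) eq ⟩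
           M (n * n + 3 + toℕ (index j))      ≡⟨ position≡ j ⟩
           toℕ (vs j)                         ∎))))
      where
      open ≡-Reasoning
      position : ∀ i → ∃ λ x → x < c × M (n * n + 3 + x) ≡ toℕ (vs i)
      position i = complete F c<k (toℕ<n (vs i)) (isKing⇒king (kings i)) (toℕ<n (vs i))
      index : Fin k → Fin c
      index i = fromℕ< (proj₁ (proj₂ (position i)))
      position≡ : ∀ i → M (n * n + 3 + toℕ (index i)) ≡ toℕ (vs i)
      position≡ i = let _ , x<c , eq = position i in
        trans (cong (λ y → M (n * n + 3 + y)) (toℕ-fromℕ< x<c)) eq

-- Word size and running time

-- `ComputesWithin` inspects the state at the exact time bound; halted states persist, so reaching
-- one earlier is enough.
reach⇒halted : ∀ {w p σ t} {Q : State → Set} → Reach w p σ t (λ σ′ → Halted p σ′ × Q σ′) →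
               Halted p (run w p t σ) × Q (run w p t σ)
reach⇒halted {w} {p} {σ} {t} {Q} (reach {s} s≤t (h , q)) = subst (λ σ′ → Halted p σ′ × Q σ′) (sym stays) (h , q)
  where
  stays : run w p t σ ≡ run w p s σ
  stays = trans (cong (λ u → run w p u σ) (sym (m+[n∸m]≡n s≤t)))
    (trans (run-+ w p s (t ∸ s) σ) (halted-stays w p (t ∸ s) _ h))

contents-< : ∀ {b xs} → All (_< b) xs → 0 < b → ∀ x → contents xs x < b
contents-< []         pos x       = pos
contents-< (x< ∷ xs<) pos zero    = x<
contents-< (x< ∷ xs<) pos (suc x) = contents-< xs< pos x

output-contents : ∀ {w p xs ys t} → ComputesWithin w p xs ys t → ∀ {x} → x < length ys →
                  State.mem (run w p t (initial xs)) (length xs + x) ≡ contents ys x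
output-contents {w} {p} {xs} {ys} {t} (_ , output) {x} x< =
  subst (λ y → State.mem (run w p t (initial xs)) (length xs + y) ≡ contents ys y) (toℕ-fromℕ< x<)
    (trans (output (fromℕ< x<)) (contents-lookup ys (fromℕ< x<)))

-- The simulation uses words of w bits on a machine with words of 1 + w bits.
module WordSize (c n w : ℕ) (1≤n : 1 ≤ n) (large : (2 + n * n) ^ (3 + 2 * c) ≤ 2 ^ suc w) where

  private
    N : ℕ
    N = 2 + n * n

    1≤nn : 1 ≤ n * n
    1≤nn = *-mono-≤ 1≤n 1≤n

    3≤N : 3 ≤ N
    3≤N = s≤s (s≤s 1≤nn)

    -- This explains the exponent `3 + 2 * c`: `N * N` exceeds the length `1 + 2 n²` of the
    -- simulated input, which needs its `c`-th power, and `N ^ 3` pays for addresses, the budget and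
    -- the lost bit.
    split : N ^ 3 * (N * N) ^ c ≤ 2 ^ suc w
    split = subst (_≤ 2 ^ suc w)
      (trans (^-distribˡ-+-* N 3 (2 * c))
        (cong (N ^ 3 *_) (trans (sym (^-*-assoc N 2 c)) (cong (λ x → (N * x) ^ c) (*-identityʳ N)))))
      large

    N³≤ : N ^ 3 ≤ 2 ^ suc w
    N³≤ = ≤-trans (m≤m*n (N ^ 3) ((N * N) ^ c) {{m^n≢0 (N * N) c}}) split

  -- Half of the memory must hold the `1 + 3 n²` cells of the factors and the product. Since
  -- `N ≥ 3`, `6 * N ≤ N ^ 3`.
  big : 3 * N ≤ 2 ^ w
  big = *-cancelˡ-≤ 2 (begin
    2 * (3 * N)        ≡⟨ *-assoc 2 3 N ⟨
    6 * N              ≤⟨ *-monoˡ-≤ N (≤-trans (m≤m+n 6 3) (*-mono-≤ 3≤N 3≤N)) ⟩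
    N * N * N          ≡⟨ *-assoc N N N ⟩
    N * (N * N)        ≡⟨ cong (λ x → N * (N * x)) (*-identityʳ N) ⟨
    N ^ 3              ≤⟨ N³≤ ⟩
    2 ^ suc w          ∎)
    where open ≤-Reasoning

  multiplication-large : (1 + (n * n + n * n)) ^ c ≤ 2 ^ w
  multiplication-large = *-cancelˡ-≤ 2 (begin
    2 * (1 + (n * n + n * n)) ^ c  ≤⟨ *-mono-≤ 2≤N³ (^-monoˡ-≤ c base≤) ⟩
    N ^ 3 * (N * N) ^ c            ≤⟨ split ⟩
    2 ^ suc w                      ∎)
    where
    open ≤-Reasoning
    2≤N³ : 2 ≤ N ^ 3
    2≤N³ = ≤-trans (s≤s (s≤s z≤n)) (m≤m*n N (N ^ 2) {{m^n≢0 N 2}})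
    base≤ : 1 + (n * n + n * n) ≤ N * N
    base≤ = begin
      1 + n * n + n * n  ≤⟨ +-mono-≤ (n≤1+n _) (m≤n+m (n * n) 2) ⟩
      N + N              ≡⟨ cong (N +_) (+-identityʳ N) ⟨
      2 * N              ≤⟨ *-monoˡ-≤ N {2} {N} (s≤s (s≤s z≤n)) ⟩
      N * N              ∎

  budget : ∀ {k} → k ≤ n → k * (n * n) < 2 ^ suc w
  budget {k} k≤n = begin-strict
    k * (n * n)  ≤⟨ *-mono-≤ (≤-trans k≤n (≤-trans (n≤n*n n) (m≤n+m (n * n) 2))) (m≤n+m (n * n) 2) ⟩
    N * N        ≡⟨ *-identityˡ (N * N) ⟨
    1 * (N * N)  <⟨ *-monoˡ-< (N * N) {1} {N} (s≤s (s≤s z≤n)) ⟩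
    N * (N * N)  ≡⟨ cong (λ x → N * (N * x)) (*-identityʳ N) ⟨
    N ^ 3        ≤⟨ N³≤ ⟩
    2 ^ suc w    ∎
    where open ≤-Reasoning

byProduct-time-≤ : ∀ {n B} → 1 ≤ B → n ≤ B → n * n ≤ B → byProduct-time n ≤ B * 104
byProduct-time-≤ {n} {B} 1≤B n≤B nn≤B = begin
  byProduct-time n             ≡⟨ expand n ⟩
  1 * 10 + n * 18 + n * n * 16
    ≤⟨ +-mono-≤ (+-mono-≤ (*-monoˡ-≤ 10 1≤B) (*-monoˡ-≤ 18 n≤B)) (*-monoˡ-≤ 16 nn≤B) ⟩
  B * 10 + B * 18 + B * 16     ≡⟨ cong (_+ B * 16) (*-distribˡ-+ B 10 18) ⟨
  B * 28 + B * 16              ≡⟨ *-distribˡ-+ B 28 16 ⟨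
  -- Rounded up to the constant of the other method, so that both share one bound.
  B * 44                       ≤⟨ *-monoʳ-≤ B (m≤m+n 44 60) ⟩
  B * 104                      ∎
  where
  open ≤-Reasoning
  open +-*-Solver
  expand : ∀ n → byProduct-time n ≡ 1 * 10 + n * 18 + n * n * 16
  expand = solve 1 (λ n →
    con 4 :+ ((n :* ((con 5 :+ ((n :* con 16 :+ con 3) :+ con 7)) :+ con 3) :+ con 3) :+ con 3) :=
    con 1 :* con 10 :+ n :* con 18 :+ n :* n :* con 16) refl

byCovering-time-≤ : ∀ {n k B} → 1 ≤ B → n ≤ B → n * n ≤ B → k * n ≤ B → k * (n * n) ≤ B →
                    byCovering-time n k ≤ B * 104
byCovering-time-≤ {n} {k} {B} 1≤B n≤B nn≤B kn≤B knn≤B = begin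
  byCovering-time n k          ≡⟨ expand n k ⟩
  1 * 18 + n * 43 + n * n * 17 + k * n * 16 + k * (n * n) * 10
    ≤⟨ +-mono-≤ (+-mono-≤ (+-mono-≤ (+-mono-≤ (*-monoˡ-≤ 18 1≤B) (*-monoˡ-≤ 43 n≤B))
         (*-monoˡ-≤ 17 nn≤B)) (*-monoˡ-≤ 16 kn≤B)) (*-monoˡ-≤ 10 knn≤B) ⟩
  B * 18 + B * 43 + B * 17 + B * 16 + B * 10  ≡⟨ collect B ⟩
  B * 104                      ∎
  where
  open ≤-Reasoning
  open +-*-Solver
  collect : ∀ B → B * 18 + B * 43 + B * 17 + B * 16 + B * 10 ≡ B * 104
  collect = solve 1 (λ B → B :* con 18 :+ B :* con 43 :+ B :* con 17 :+ B :* con 16 :+ B :* con 10 := B :* con 104) refl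
  expand : ∀ n k → byCovering-time n k ≡ 1 * 18 + n * 43 + n * n * 17 + k * n * 16 + k * (n * n) * 10
  expand = solve 2 (λ n k →
    con 3 :+ ((n :* ((con 4 :+ ((n :* con 8 :+ con 3) :+ con 2)) :+ con 3) :+ con 3) :+
      (((n :+ con 1) :* (n :* con 9 :+ con 6) :+
        n :* (con 2 :+ (con 4 :+ ((k :* (con 7 :+ ((n :* con 10 :+ con 3) :+ con 3) :+ con 3) :+ con 3) :+ con 7))) :+ con 3) :+ con 3)) :=
    con 1 :* con 18 :+ n :* con 43 :+ n :* n :* con 17 :+ k :* n :* con 16 :+ k :* (n :* n) :* con 10) refl

n<⇐big : ∀ {n P} → 3 * (2 + n * n) ≤ P → n < P
n<⇐big {n} big = ≤-trans (≤-trans (s≤s (n≤n*n n)) (≤-trans (n≤1+n _) (m≤m+n _ _))) big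

-- The assembled program

module KingsProgram (p : Program) where

  -- Each `suc` skips the single instruction between two pieces; `endAt` is the `halt` after the
  -- second method, which also serves the case `k > n`.
  copyAt byProductAt byCoveringAt endAt simulationAt : Label
  copyAt       = suc (next 0 setup)
  byProductAt  = suc (next copyAt copy)
  byCoveringAt = suc (next byProductAt byProduct)
  endAt        = next byCoveringAt byCovering
  simulationAt = suc endAt

  open Simulation p simulationAt byProductAt byCoveringAt public

  kingsProgram : Program
  kingsProgram =
    compile 0 setup (jlt 2 3 endAt ∷
    compile copyAt copy (jump simulationAt ∷
    compile byProductAt byProduct (halt ∷
    compile byCoveringAt byCovering (halt ∷
    blocks simulationAt (p ++ halt ∷ [])))))

  private
    layout₀ = locate {kingsProgram} {0} setup (suffix λ _ → refl)
    layout₁ = locate copy (suffix-tail (proj₂ layout₀))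
    layout₂ = locate byProduct (suffix-tail (proj₂ layout₁))
    layout₃ = locate byCovering (suffix-tail (proj₂ layout₂))

  module _ {n k w : ℕ} (T : Tournament n) (1≤n : 1 ≤ n)
           (big : 3 * (2 + n * n) ≤ 2 ^ w) (budget : k ≤ n → k * (n * n) < 2 ^ suc w)
           {t B : ℕ}
           (computes : ComputesWithin w p (n ∷ rowMajor (adjacency T) ++ rowMajor (adjacency T))
                         (rowMajor (adjacency T ⊗ adjacency T)) t)
           (nn≤B : n * n ≤ B) (bound : t ⊓ (k * (n * n)) ≤ B)
    where

    private
      xs ps : List ℕ
      xs = rowMajor (adjacency T)
      ps = rowMajor (adjacency T ⊗ adjacency T)
      M₀ : Mem
      M₀ = contents (n ∷ k ∷ xs)
      P nn pb : ℕ
      P  = 2 ^ w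
      nn = n * n
      pb = P + 1 + nn + nn

      Goal : State → Set
      Goal σ = Halted kingsProgram σ × ∃ λ ys → KingsOutput T k ys × (∀ i → State.mem σ (nn + 2 + toℕ i) ≡ lookup ys i)

      1≤B : 1 ≤ B
      1≤B = ≤-trans (*-mono-≤ 1≤n 1≤n) nn≤B

      n≤B : n ≤ B
      n≤B = ≤-trans (n≤n*n n) nn≤B

      3nn+6≤P : nn + nn + nn + 6 ≤ P
      3nn+6≤P = ≤-trans (≤-reflexive (expand nn)) big
        where
        open +-*-Solver
        expand : ∀ x → x + x + x + 6 ≡ 3 * (2 + x)
        expand = solve 1 (λ x → x :+ x :+ x :+ con 6 := con 3 :* (con 2 :+ x)) refl

      1+3nn<P : 1 + (nn + nn + nn) < P
      1+3nn<P = ≤-trans (≤-trans (≤-reflexive (+-comm 2 _)) (+-monoʳ-≤ (nn + nn + nn) (m≤m+n 2 4))) 3nn+6≤P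

      nn+3≤P : nn + 3 ≤ P
      nn+3≤P = ≤-trans (+-mono-≤ (m≤n+m nn (nn + nn)) (m≤m+n 3 3)) 3nn+6≤P

      blank : ∀ x → nn + 2 ≤ x → M₀ x ≡ 0
      blank x le = contents-beyond (n ∷ k ∷ xs)
        (subst (_≤ x) (trans (+-comm nn 2) (cong (2 +_) (sym (length-rowMajor (adjacency T))))) le)

      entries : ∀ {M : Mem} → (∀ {x} → x < P → M x ≡ M₀ x) →
                ∀ {u v} → u < n → v < n → M (u * n + 2 + v) ≡ arcs T u v
      entries lower {u} {v} u<n v<n = trans
        (lower (<-≤-trans (address-< 2 u<n v<n) (≤-trans (≤-reflexive (+-comm 2 nn)) (≤-trans (+-monoʳ-≤ nn (s≤s (s≤s z≤n))) nn+3≤P))))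
        (cong M₀ (trans (cong (_+ v) (+-comm (u * n) 2)) (+-assoc 2 (u * n) v)))

      blank′ : ∀ {M : Mem} → (∀ {x} → x < P → M x ≡ M₀ x) → M (nn + 2) ≡ 0
      blank′ lower = trans (lower (<-≤-trans (+-monoʳ-< nn ≤-refl) nn+3≤P)) (blank (nn + 2) ≤-refl)

      finished : ∀ {l σ} → fetch kingsProgram l ≡ halt → EndsAt l (λ _ M → Answer n (arcs T) k M) σ → Goal σ
      finished {l} {state _ _ M} h (refl , answer) = h , answer⇒output T {M = M} answer

      afterSimulation : ∀ {σ} → k ≤ n → Outcome {w} {n} {k} {M₀} t (k * nn) (initial (n ∷ xs ++ xs)) σ →
        Reach (suc w) kingsProgram σ (B * 104) Goal
      afterSimulation {state _ R M} k≤n (inj₁ (refl , _ , S)) =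
        reach-mono (byProduct-time-≤ 1≤B n≤B nn≤B) (λ {σ} → finished {σ = σ} (suffix-head (proj₂ layout₂)))
          (exec-at (byProduct-exec (arcs-tournament T) (paths-product T) fits fits′ (proj₁ (own S))
            (entries (lower≡ S)) product (blank′ (lower≡ S)) (λ answer → answer)) (proj₁ layout₂))
        where
        open Simulates
        fits : nn + 3 + k ≤ pb
        fits = +-mono-≤ (≤-trans nn+3≤P (≤-trans (m≤m+n P 1) (m≤m+n (P + 1) nn))) (≤-trans k≤n (n≤n*n n))
        fits′ : pb + nn < 2 ^ suc w
        fits′ = subst₂ _<_ (expand P nn) (sym (2^1+w w)) (+-monoʳ-< P 1+3nn<P)
          where
          open +-*-Solver
          expand : ∀ P x → P + (1 + (x + x + x)) ≡ P + 1 + x + x + x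
          expand = solve 2 (λ P x → P :+ (con 1 :+ (x :+ x :+ x)) := P :+ con 1 :+ x :+ x :+ x) refl
        product : ∀ {u v} → u < n → v < n → M (u * n + pb + v) ≡ paths T u v
        product {u} {v} u<n v<n = begin
          M (u * n + pb + v)                        ≡⟨ cong M (rearrange u v) ⟩
          M (1 + (nn + nn) + (u * n + v) + P)       ≡⟨ upper≡ S cell<P ⟩
          result (1 + (nn + nn) + (u * n + v))      ≡⟨ cong (λ l → result (suc l + (u * n + v))) (length-rowMajor² (adjacency T) (adjacency T)) ⟨
          result (length (n ∷ xs ++ xs) + (u * n + v))
            ≡⟨ output-contents {w} {p} {n ∷ xs ++ xs} {ps} {t} computes (subst (u * n + v <_) (sym (length-rowMajor (adjacency T ⊗ adjacency T))) (entry-< u<n v<n)) ⟩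
          paths T u v                               ∎
          where
          open ≡-Reasoning
          result : Mem
          result = State.mem (run w p t (initial (n ∷ xs ++ xs)))
          cell<P : 1 + (nn + nn) + (u * n + v) < P
          cell<P = <-trans (+-monoʳ-< (1 + (nn + nn)) (entry-< u<n v<n)) 1+3nn<P
          rearrange : ∀ u v → u * n + pb + v ≡ 1 + (nn + nn) + (u * n + v) + P
          rearrange u v = solve 4 (λ r v P x → r :+ (P :+ con 1 :+ x :+ x) :+ v := con 1 :+ (x :+ x) :+ (r :+ v) :+ P)
            refl (u * n) v P nn
            where open +-*-Solver
      afterSimulation {state _ R M} k≤n (inj₂ (refl , knn≤t , base , lower)) =
        reach-mono (byCovering-time-≤ {n} {k} 1≤B n≤B nn≤B (≤-trans (*-monoʳ-≤ k (n≤n*n n)) knn≤B) knn≤B)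
          (λ {σ} → finished {σ = σ} (suffix-head (proj₂ layout₃)))
          (exec-at (byCovering-exec (arcs-tournament T) k≤n fits base (entries lower) (blank′ lower) (λ answer → answer)) (proj₁ layout₃))
        where
        knn≤B : k * nn ≤ B
        -- The simulation gave up, so `k n² ≤ t`, and the minimum bounded by `B` is `k n²` itself.
        knn≤B = subst (_≤ B) (m≥n⇒m⊓n≡n knn≤t) bound
        fits : nn + 3 + n + n < 2 ^ suc w
        fits = ≤-<-trans (≤-trans (+-mono-≤ (+-monoʳ-≤ (nn + 3) (n≤n*n n)) (n≤n*n n))
          (≤-trans (≤-trans (≤-reflexive (expand nn)) (+-monoʳ-≤ (nn + nn + nn) (m≤m+n 3 3))) 3nn+6≤P)) (2^w<2^1+w w)
          where
          open +-*-Solver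
          expand : ∀ x → x + 3 + x + x ≡ x + x + x + 3
          expand = solve 1 (λ x → x :+ con 3 :+ x :+ x := x :+ x :+ x :+ con 3) refl

    -- The constant is 26 + 9 + 5 + 104: fixed overhead, copying of `n²` entries, the simulated
    -- steps, and whichever method follows.
    kings-reach : Reach (suc w) kingsProgram (initial (n ∷ k ∷ xs)) (B * 144) Goal
    kings-reach = reach-mono time (λ g → g)
      (reach-bind
        (exec-at (setup-exec {Q = λ R M → Base n k P R × (∀ r → R (32 + r) ≡ 0) × M ≡ M₀} nn+3≤P (λ base z → base , z , refl))
                 (proj₁ layout₀))
        λ { (state _ R _) (refl , base@(_ , _ , r2 , r3 , _) , z , refl) →
          reach-step (suffix-head (proj₂ layout₀))
            (subst₂ (λ u v → Reach (suc w) kingsProgram (state (if u <ᵇ v then endAt else copyAt) R M₀) rest Goal)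
              (sym r2) (sym r3) (branch base z)) })
      where
      rest : ℕ
      rest = (5 + (nn * (6 + 3) + 3)) + (1 + (((t ⊓ (k * nn)) * 5 + 5) + B * 104))

      time : 11 + (1 + rest) ≤ B * 144
      time = begin
        11 + (1 + rest)                                            ≡⟨ expand nn (t ⊓ (k * nn)) B ⟩
        1 * 26 + nn * 9 + (t ⊓ (k * nn)) * 5 + B * 104
          ≤⟨ +-monoˡ-≤ (B * 104) (+-mono-≤ (+-mono-≤ (*-monoˡ-≤ 26 1≤B) (*-monoˡ-≤ 9 nn≤B)) (*-monoˡ-≤ 5 bound)) ⟩
        B * 26 + B * 9 + B * 5 + B * 104                           ≡⟨ collect B ⟩
        B * 144                                                    ∎
        where
        open ≤-Reasoning
        open +-*-Solver
        expand : ∀ x y z → 11 + (1 + ((5 + (x * (6 + 3) + 3)) + (1 + ((y * 5 + 5) + z * 104)))) ≡ 1 * 26 + x * 9 + y * 5 + z * 104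
        expand = solve 3 (λ x y z →
          con 11 :+ (con 1 :+ ((con 5 :+ (x :* con 9 :+ con 3)) :+ (con 1 :+ ((y :* con 5 :+ con 5) :+ z :* con 104)))) :=
          con 1 :* con 26 :+ x :* con 9 :+ y :* con 5 :+ z :* con 104) refl
        collect : ∀ z → z * 26 + z * 9 + z * 5 + z * 104 ≡ z * 144
        collect = solve 1 (λ z → z :* con 26 :+ z :* con 9 :+ z :* con 5 :+ z :* con 104 := z :* con 144) refl

      0<P : 0 < P
      0<P = m^n>0 2 w

      words : All (_< P) (n ∷ xs ++ xs)
      words = n<⇐big big ∷ ++⁺ bits bits
        where
        bits : All (_< P) xs
        bits = all-rowMajor (adjacency T) λ i j → ≤-<-trans (≤-trans (adjacency≤1 T i j) 1≤n) (n<⇐big big)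

      branch : ∀ {R} → Base n k P R → (∀ r → R (32 + r) ≡ 0) →
               Reach (suc w) kingsProgram (state (if n <ᵇ k then endAt else copyAt) R M₀) rest Goal
      branch {R} base z with <-≤-connex n k
      ... | inj₁ n<k = subst (λ b → Reach (suc w) kingsProgram (state (if b then endAt else copyAt) R M₀) rest Goal)
        (sym (<⇒<ᵇ≡true n<k))
        -- Nothing has been written; the blank cell after the input already reads as ⊥.
        (reach-done (suffix-head (proj₂ layout₃) , 0 ∷ [] , inj₂ (n<k⇒¬distinctKings T n<k , refl) ,
          λ { zero → blank _ (m≤m+n (nn + 2) 0) }))
      ... | inj₂ k≤n = subst (λ b → Reach (suc w) kingsProgram (state (if b then endAt else copyAt) R M₀) rest Goal)
        (sym (≥⇒<ᵇ≡false k≤n))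
        (reach-bind
          (exec-at (copy-exec {Q = Simulates w n k M₀ (k * nn) (λ _ → 0) (contents (n ∷ xs ++ xs))}
              (length-rowMajor (adjacency T)) nn+3≤P
              (≤-trans (s≤s (+-monoˡ-≤ nn (m≤m+n nn nn))) (<⇒≤ 1+3nn<P))
              (budget k≤n) base z
              (λ x P≤x → blank x (≤-trans (≤-trans (+-monoʳ-≤ nn (s≤s (s≤s z≤n))) nn+3≤P) P≤x))
              (λ base′ r7 z′ lower upper →
                simulates (base′ , r7) z′ (λ _ → 0<P) lower upper (contents-< words 0<P)))
            (proj₁ layout₁))
          λ { (state _ _ _) (refl , S) → reach-step (suffix-head (proj₂ layout₁))
            (reach-bind (simulation (suffix-tail (proj₂ layout₃)) t (k * nn) 0 (budget k≤n) S (proj₁ computes))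
              (λ σ outcome → afterSimulation k≤n outcome)) })

theorem1p5 : (M : ℕ → ℕ) →
    SolvableInTimeO matrixMultiplication (λ x → M (MatrixPair.n x)) →
    SolvableInTimeO kKings
    (λ x → M (KingsInstance.n x) ⊓ (KingsInstance.k x * KingsInstance.n x ^ 2))
theorem1p5 M (p , c , C , solves) = kingsProgram , 3 + 2 * c , suc C * 144 , solve
  where
  open KingsProgram p
  solve : ∀ w x → length (Problem.input kKings x) ^ (3 + 2 * c) ≤ 2 ^ w → Problem.Fits kKings w x →
    ∃ λ ys → Problem.Output kKings x ys × ComputesWithin w kingsProgram (Problem.input kKings x) ys
      (suc C * 144 * (M (KingsInstance.n x) ⊓ (KingsInstance.k x * KingsInstance.n x ^ 2)))
  -- The simulation needs a bit to give away. Words of 0 bits are excluded, since `2 ^ 0` is less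
  -- than the length of the input.
  solve zero x large _ = contradiction large (<⇒≱ (≤-trans (s≤s (s≤s z≤n))
    (m≤m*n (length (Problem.input kKings x)) (length (Problem.input kKings x) ^ (2 + 2 * c)) {{m^n≢0 (length (Problem.input kKings x)) (2 + 2 * c)}})))
  solve (suc w) x large _ = finally (solves w pair large-pair fits-pair)
    where
    open KingsInstance x
    A : Matrix n
    A = adjacency T
    open WordSize c n w 1≤n (subst (λ l → (2 + l) ^ (3 + 2 * c) ≤ 2 ^ suc w) (length-rowMajor A) large)
    pair : MatrixPair
    pair = record { n = n ; 1≤n = 1≤n ; A = A ; B = A }
    large-pair : length (n ∷ rowMajor A ++ rowMajor A) ^ c ≤ 2 ^ w
    large-pair = subst (λ l → suc l ^ c ≤ 2 ^ w) (sym (length-rowMajor² A A)) multiplication-large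
    fits-pair : Problem.Fits matrixMultiplication w pair
    fits-pair = n<⇐big big ∷ ++⁺ bits bits , all-rowMajor (A ⊗ A) λ i j →
      ≤-<-trans (⊗-≤ A A (adjacency≤1 T) (adjacency≤1 T) i j) (n<⇐big big)
      where
      bits : All (_< 2 ^ w) (rowMajor A)
      bits = all-rowMajor A λ i j → ≤-<-trans (≤-trans (adjacency≤1 T i j) 1≤n) (n<⇐big big)
    f : ℕ
    f = M n ⊓ (k * n ^ 2)
    knn≡ : k * (n * n) ≡ k * n ^ 2
    knn≡ = cong (λ m → k * (n * m)) (sym (*-identityʳ n))
    -- The factor is `suc C` because `C` might be `0`, while the bound by `k n²` needs a factor of
    -- at least 1.
    below : ∀ {m} → m ≤ C * M n → m ≤ k * (n * n) → m ≤ suc C * f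
    below {m} le₁ le₂ = subst (m ≤_) (sym (*-distribˡ-⊓ (suc C) (M n) (k * n ^ 2)))
      (⊓-glb (≤-trans le₁ (m≤n+m _ (M n))) (≤-trans le₂ (≤-trans (≤-reflexive knn≡) (m≤m+n _ _))))
    nn≤ : n * n ≤ C * M n
    nn≤ = multiplication-≥n² {w} {p} {c} 1≤n
      (λ y eq l fits → subst (λ m → ∃ λ ys → Problem.Output matrixMultiplication y ys ×
                         ComputesWithin w p (Problem.input matrixMultiplication y) ys (C * M m)) eq (solves w y l fits))
      multiplication-large (n<⇐big big)
    finally : (∃ λ ys → Problem.Output matrixMultiplication pair ys ×
                ComputesWithin w p (Problem.input matrixMultiplication pair) ys (C * M n)) →
              ∃ λ ys → Problem.Output kKings x ys ×
                ComputesWithin (suc w) kingsProgram (Problem.input kKings x) ys (suc C * 144 * f)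
    finally (_ , refl , computes) =
      let halted , ys , output , memory = reach⇒halted (kings-reach T 1≤n big budget computes
            (below nn≤ (m≤n*m (n * n) k {{>-nonZero 1≤k}})) (below (m⊓n≤m _ _) (m⊓n≤n _ _)))
      in ys , output , subst (ComputesWithin (suc w) kingsProgram (n ∷ k ∷ rowMajor A) ys) time≡
           (halted , λ i → trans
             (cong (State.mem (run (suc w) kingsProgram (suc C * f * 144) (initial (n ∷ k ∷ rowMajor A)))) (address (toℕ i)))
             (memory i))
      where
      time≡ : suc C * f * 144 ≡ suc C * 144 * f
      time≡ = trans (*-assoc (suc C) f 144) (trans (cong (suc C *_) (*-comm f 144)) (sym (*-assoc (suc C) 144 f)))
      address : ∀ i → 2 + length (rowMajor A) + i ≡ n * n + 2 + i
      address i = cong (_+ i) (trans (cong (2 +_) (length-rowMajor A)) (+-comm 2 (n * n)))
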